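{- Let $n$ be a positive integer and let $k, c$ be complex numbers. Then \[ \sum_{\pi\in\mathcal{D}(n)} (-1)^{\#(\pi)-1} \sum_{j=1}^{s(\pi)} j^k c^j = \sum_{\substack{\pi\in\mathcal{P}(n)\\ \nu_d(\pi)\ge 2}} \sum_{j=0}^{\nu_d(\pi)-1} (-1)^j \binom{\nu_d(\pi)-1}{j} \bigl(\ell(\pi)-j\bigr)^k c^{\ell(\pi)-j} + \sigma_{k,c}(n), \] where $\sigma_{k,c}(n) = \sum_{d\mid n} d^k c^d$.
   Context: $\mathcal{P}(n)$ is the set of all partitions of $n$ and $\mathcal{D}(n)$ the set of partitions of $n$ into distinct parts. For a partition $\pi$: $s(\pi)$ is its smallest part, $\ell(\pi)$ its largest part, $\#(\pi)$ its number of parts, and $\nu_d(\pi)$ the number of distinct part sizes of $\pi$. For a positive integer $m$ and complex $k$, $m^k=e^{k\log m}$ with the real logarithm. -}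

module Defs where

open import Algebra.Bundles.Raw using (RawRing)
import Algebra.Definitions.RawSemiring as RawSemiringDefs
open import Data.Integer.Base as ℤ using (+_; +[1+_]; -[1+_])
import Data.Integer.Properties as ℤ
open import Data.List.Base
  using (List; []; _∷_; [_]; map; concatMap; foldr; filter; length; upTo; applyUpTo; deduplicate)
open import Data.List.Extrema.Nat using (min; max)
open import Data.List.Membership.Propositional using (_∈_; find; lose)
open import Data.List.Membership.Propositional.Properties
  using (∈-map⁺; ∈-map⁻; ∈-concatMap⁺; ∈-concatMap⁻; ∈-upTo⁺; ∈-upTo⁻)
import Data.List.Properties as List
open import Data.List.Relation.Unary.All as All using (All; []; _∷_)
import Data.List.Relation.Unary.All.Properties as All
open import Data.List.Relation.Unary.AllPairs as AllPairs using (AllPairs; []; _∷_)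
import Data.List.Relation.Unary.AllPairs.Properties as AllPairs
open import Data.List.Relation.Unary.Any as Any using (here; there)
import Data.List.Relation.Unary.Any.Properties as Any
open import Data.List.Relation.Unary.Linked as Linked using (Linked; []; [-]; _∷_)
import Data.List.Relation.Unary.Linked.Properties as Linked
open import Data.List.Relation.Unary.Unique.Propositional using (Unique)
import Data.List.Relation.Unary.Unique.Propositional.Properties as Unique
open import Data.Nat.Base as ℕ using (ℕ; zero; suc; _!)
open import Data.Nat.Coprimality as Coprime using (1-coprimeTo)
open import Data.Nat.ListAction using (sum)
open import Data.Nat.Divisibility using (_∣?_)
import Data.Nat.Properties as ℕ
open import Data.List.Relation.Unary.Unique.DecPropositional ℕ._≟_ using (unique?)
open import Data.Product.Base using (_×_; _,_; proj₁; proj₂; ∃-syntax)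
open import Data.Rational.Base as ℚ
  using (ℚ; mkℚ; 0ℚ; 1ℚ; ∣_∣; _/_; *≤*; *<*)
import Data.Rational.Properties as ℚ
open import Data.Rational.Solver using (module +-*-Solver)
open import Data.Sum.Base using (inj₁; inj₂)
open import Function.Bundles using (_⇔_; mk⇔)
open import Level using (0ℓ)
open import Relation.Binary.PropositionalEquality hiding ([_])
open import Relation.Nullary.Negation using (¬_)

module Real where
  open import Data.Rational.Base using (_+_; _*_; _-_; -_; _≤_; _<_; positive; nonNegative; ↥_)
  open import Algebra.Definitions.RawSemiring ℚ.+-*-rawSemiring using (_^_)
  open import Data.Nat.Base using () renaming (_≤_ to _≤ⁿ_)
  open +-*-Solver using (solve; _:+_; _:*_; _:-_; :-_; _:=_; con)

  Cauchy : (ℕ → ℚ) → Set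
  Cauchy x = ∀ ε → 0ℚ < ε → ∃[ N ] ∀ i j → N ≤ⁿ i → N ≤ⁿ j → ∣ x i - x j ∣ < ε

  -- Reals are Cauchy sequences of rationals, compared by _≈ᴿ_; all operations are pointwise.
  record ℝ : Set where
    constructor mkℝ
    field
      seq    : ℕ → ℚ
      cauchy : Cauchy seq
  open ℝ public

  infix 4 _≈ᴿ_
  _≈ᴿ_ : ℝ → ℝ → Set
  x ≈ᴿ y = ∀ ε → 0ℚ < ε → ∃[ N ] ∀ i → N ≤ⁿ i → ∣ seq x i - seq y i ∣ < ε

  ι : ℕ → ℚ
  ι n = + n / 1

  ι-form : ∀ n → ι n ≡ mkℚ (+ n) 0 (Coprime.sym (1-coprimeTo n))
  ι-form n = ℚ.normalize-coprime (Coprime.sym (1-coprimeTo n))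

  ι-+ : ∀ m n → ι (m ℕ.+ n) ≡ ι m + ι n
  ι-+ m n = trans (cong (_/ 1) (sym (cong₂ ℤ._+_ (ℤ.*-identityʳ (+ m)) (ℤ.*-identityʳ (+ n)))))
                  (sym (cong₂ _+_ (ι-form m) (ι-form n)))

  ι-* : ∀ m n → ι (m ℕ.* n) ≡ ι m * ι n
  ι-* m n = trans (cong (_/ 1) (ℤ.pos-* m n)) (sym (cong₂ _*_ (ι-form m) (ι-form n)))

  ι-mono-≤ : ∀ {m n} → m ≤ⁿ n → ι m ≤ ι n
  ι-mono-≤ {m} {n} m≤n = subst₂ _≤_ (sym (ι-form m)) (sym (ι-form n))
    (*≤* (ℤ.*-monoʳ-≤-nonNeg (+ 1) (ℤ.+≤+ m≤n)))

  0≤ι : ∀ n → 0ℚ ≤ ι n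
  0≤ι n = ι-mono-≤ {0} {n} ℕ.z≤n

  ι-mono-< : ∀ {m n} → m ℕ.< n → ι m < ι n
  ι-mono-< {m} {n} m<n = subst₂ _<_ (sym (ι-form m)) (sym (ι-form n))
    (*<* (ℤ.*-monoʳ-<-pos (+ 1) (ℤ.+<+ m<n)))

  recip : (d : ℕ) .{{_ : ℕ.NonZero d}} → ℚ
  recip d = + 1 / d

  ι*recip : ∀ d .{{_ : ℕ.NonZero d}} → ι d * recip d ≡ 1ℚ
  ι*recip (suc d) = trans
    (cong₂ _*_ (ι-form (suc d)) (ℚ.normalize-coprime (1-coprimeTo (suc d))))
    (ℚ.*-inverseʳ (mkℚ (+ suc d) 0 (Coprime.sym (1-coprimeTo (suc d)))))

  0<recip : ∀ d .{{_ : ℕ.NonZero d}} → 0ℚ < recip d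
  0<recip d = ℚ.positive⁻¹ (recip d) {{ℚ.normalize-pos 1 d}}

  0<* : ∀ {p q} → 0ℚ < p → 0ℚ < q → 0ℚ < p * q
  0<* {p} {q} 0<p 0<q = subst (_< p * q) (ℚ.*-zeroʳ p) (ℚ.*-monoʳ-<-pos p {{positive 0<p}} 0<q)

  0≤* : ∀ {p q} → 0ℚ ≤ p → 0ℚ ≤ q → 0ℚ ≤ p * q
  0≤* {p} {q} 0≤p 0≤q = subst (_≤ p * q) (ℚ.*-zeroʳ p) (ℚ.*-monoˡ-≤-nonNeg p {{nonNegative 0≤p}} 0≤q)

  *-mono : ∀ {a b c d} → 0ℚ ≤ a → a ≤ b → 0ℚ ≤ c → c ≤ d → a * c ≤ b * d
  *-mono {a} {b} {c} {d} 0≤a a≤b 0≤c c≤d = ℚ.≤-trans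
    (ℚ.*-monoʳ-≤-nonNeg c {{nonNegative 0≤c}} a≤b)
    (ℚ.*-monoˡ-≤-nonNeg b {{nonNegative (ℚ.≤-trans 0≤a a≤b)}} c≤d)

  ∣*∣≤ : ∀ p q {a b} → ∣ p ∣ ≤ a → ∣ q ∣ ≤ b → ∣ p * q ∣ ≤ a * b
  ∣*∣≤ p q p≤ q≤ = subst (_≤ _) (sym (ℚ.∣p*q∣≡∣p∣*∣q∣ p q))
    (*-mono (ℚ.0≤∣p∣ p) p≤ (ℚ.0≤∣p∣ q) q≤)

  ∣+∣≤ : ∀ p q {a b} → ∣ p ∣ ≤ a → ∣ q ∣ ≤ b → ∣ p + q ∣ ≤ a + b
  ∣+∣≤ p q p≤ q≤ = ℚ.≤-trans (ℚ.∣p+q∣≤∣p∣+∣q∣ p q) (ℚ.+-mono-≤ p≤ q≤)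

  ∣-∣-sym : ∀ p q → ∣ p - q ∣ ≡ ∣ q - p ∣
  ∣-∣-sym p q = trans (cong ∣_∣ (solve 2 (λ p q → p :- q := :- (q :- p)) refl p q)) (ℚ.∣-p∣≡∣p∣ (q - p))

  shrink : ∀ (L : ℕ) ε → 0ℚ < ε → ∃[ δ ] (0ℚ < δ × ι L * δ < ε)
  shrink L ε 0<ε = ε * recip (suc L) , 0<δ , (begin-strict
      ι L * δ        <⟨ ℚ.*-monoˡ-<-pos δ {{positive 0<δ}} (ι-mono-< (ℕ.n<1+n L)) ⟩
      ι (suc L) * δ  ≡⟨ solve 3 (λ a e r → a :* (e :* r) := e :* (a :* r)) refl (ι (suc L)) ε (recip (suc L)) ⟩
      ε * (ι (suc L) * recip (suc L)) ≡⟨ cong (ε *_) (ι*recip (suc L)) ⟩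
      ε * 1ℚ         ≡⟨ ℚ.*-identityʳ ε ⟩
      ε ∎)
    where
    open ℚ.≤-Reasoning
    δ = ε * recip (suc L)
    0<δ : 0ℚ < δ
    0<δ = 0<* 0<ε (0<recip (suc L))

  archimedean : ∀ D ε → 0ℚ < ε → ∃[ N ] ι D < ι N * ε
  archimedean D ε@(mkℚ +[1+ n ] d _) _ = suc D ℕ.* suc d , (begin-strict
      ι D                              <⟨ ι-mono-< (ℕ.n<1+n D) ⟩
      ι (suc D)                        ≡⟨ sym (ℚ.*-identityʳ _) ⟩
      ι (suc D) * 1ℚ                   ≡⟨ cong (ι (suc D) *_) (sym (ι*recip (suc d))) ⟩
      ι (suc D) * (ι (suc d) * recip (suc d)) ≡⟨ sym (ℚ.*-assoc (ι (suc D)) (ι (suc d)) _) ⟩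
      ι (suc D) * ι (suc d) * recip (suc d) ≡⟨ cong (_* recip (suc d)) (sym (ι-* (suc D) (suc d))) ⟩
      ι (suc D ℕ.* suc d) * recip (suc d) ≤⟨ ℚ.*-monoˡ-≤-nonNeg (ι (suc D ℕ.* suc d)) {{nonNegative (0≤ι (suc D ℕ.* suc d))}} recip≤ε ⟩
      ι (suc D ℕ.* suc d) * ε ∎)
    where
    open ℚ.≤-Reasoning
    recip≤ε : recip (suc d) ≤ ε
    recip≤ε = subst (_≤ ε) (sym (ℚ.normalize-coprime (1-coprimeTo (suc d))))
      (*≤* (ℤ.*-monoʳ-≤-nonNeg (+ suc d) (ℤ.+≤+ {1} {suc n} (ℕ.s≤s ℕ.z≤n))))
  archimedean D (mkℚ (+ 0) _ _) (*<* (ℤ.+<+ ()))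
  archimedean D (mkℚ -[1+ _ ] _ _) (*<* ())

  cauchy-≤ : ∀ (x : ℕ → ℚ) →
    (∀ ε → 0ℚ < ε → ∃[ N ] ∀ i j → N ≤ⁿ i → i ≤ⁿ j → ∣ x j - x i ∣ < ε) → Cauchy x
  cauchy-≤ x h ε 0<ε with h ε 0<ε
  ... | N , close = N , go
    where
    go : ∀ i j → N ≤ⁿ i → N ≤ⁿ j → ∣ x i - x j ∣ < ε
    go i j N≤i N≤j with ℕ.≤-total i j
    ... | inj₁ i≤j = subst (_< ε) (∣-∣-sym (x j) (x i)) (close i j N≤i i≤j)
    ... | inj₂ j≤i = close j i N≤j j≤i

  numerator-bound : ∀ q → ∣ q ∣ ≤ ι ℤ.∣ ↥ q ∣
  numerator-bound q@(mkℚ n d _) = subst (∣ q ∣ ≤_) (sym (ι-form ℤ.∣ n ∣))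
    (*≤* (ℤ.*-monoˡ-≤-nonNeg (+ ℤ.∣ n ∣) (ℤ.+≤+ (ℕ.s≤s (ℕ.z≤n {d})))))

  prefix-bound : (x : ℕ → ℚ) (N : ℕ) → ∃[ B ] ∀ i → i ≤ⁿ N → ∣ x i ∣ ≤ ι B
  prefix-bound x zero = ℤ.∣ ↥ x 0 ∣ , λ { zero ℕ.z≤n → numerator-bound (x 0) }
  prefix-bound x (suc N) with prefix-bound x N
  ... | B , h = B ℕ.+ b , go
    where
    b = ℤ.∣ ↥ x (suc N) ∣
    go : ∀ i → i ≤ⁿ suc N → ∣ x i ∣ ≤ ι (B ℕ.+ b)
    go i i≤ with ℕ.m≤n⇒m<n∨m≡n i≤
    ... | inj₁ i<  = ℚ.≤-trans (h i (ℕ.s≤s⁻¹ i<)) (ι-mono-≤ (ℕ.m≤m+n B b))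
    ... | inj₂ refl = ℚ.≤-trans (numerator-bound (x (suc N))) (ι-mono-≤ (ℕ.m≤n+m b B))

  bounded : ∀ x → Cauchy x → ∃[ K ] ∀ i → ∣ x i ∣ ≤ ι (suc K)
  bounded x cx with cx 1ℚ (ℚ.positive⁻¹ 1ℚ)
  ... | N , close with prefix-bound x N
  ... | B , h = B , go
    where
    open ℚ.≤-Reasoning
    go : ∀ i → ∣ x i ∣ ≤ ι (suc B)
    go i with ℕ.≤-total i N
    ... | inj₁ i≤N = ℚ.≤-trans (h i i≤N) (ι-mono-≤ (ℕ.n≤1+n B))
    ... | inj₂ N≤i = begin
      ∣ x i ∣ ≡⟨ cong ∣_∣ (solve 2 (λ a b → a := (a :- b) :+ b) refl (x i) (x N)) ⟩
      ∣ (x i - x N) + x N ∣ ≤⟨ ∣+∣≤ (x i - x N) (x N) (ℚ.<⇒≤ (close i N N≤i ℕ.≤-refl)) (h N ℕ.≤-refl) ⟩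
      1ℚ + ι B ≡⟨ sym (ι-+ 1 B) ⟩
      ι (suc B) ∎

  cauchy-const : ∀ q → Cauchy (λ _ → q)
  cauchy-const q ε 0<ε = 0 , λ _ _ _ _ → subst (_< ε) (sym (cong ∣_∣ (ℚ.+-inverseʳ q))) 0<ε

  cauchy-neg : ∀ x → Cauchy x → Cauchy (λ i → - x i)
  cauchy-neg x cx ε 0<ε with cx ε 0<ε
  ... | N , close = N , λ i j N≤i N≤j → subst (_< ε)
    (trans (∣-∣-sym (x i) (x j))
      (cong ∣_∣ (solve 2 (λ a b → b :- a := (:- a) :- (:- b)) refl (x i) (x j))))
    (close i j N≤i N≤j)

  -- A sequence whose increments are bounded by a linear combination of those of two Cauchy
  -- sequences is Cauchy.
  cauchy-dominated : ∀ (x y z : ℕ → ℚ) (K L : ℕ) → Cauchy x → Cauchy y →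
    (∀ i j → i ≤ⁿ j → ∣ z j - z i ∣ ≤ ι K * ∣ x j - x i ∣ + ι L * ∣ y j - y i ∣) → Cauchy z
  cauchy-dominated x y z K L cx cy h = cauchy-≤ z λ ε 0<ε →
    let δ , 0<δ , small = shrink (K ℕ.+ L) ε 0<ε
        M , closeˣ = cx δ 0<δ
        N , closeʸ = cy δ 0<δ
    in M ℕ.⊔ N , λ i j ≤i i≤j →
      let open ℚ.≤-Reasoning
          M≤i = ℕ.≤-trans (ℕ.m≤m⊔n M N) ≤i
          N≤i = ℕ.≤-trans (ℕ.m≤n⊔m M N) ≤i
      in begin-strict
        ∣ z j - z i ∣ ≤⟨ h i j i≤j ⟩
        ι K * ∣ x j - x i ∣ + ι L * ∣ y j - y i ∣ ≤⟨ ℚ.+-mono-≤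
           (ℚ.*-monoˡ-≤-nonNeg (ι K) {{nonNegative (0≤ι K)}} (ℚ.<⇒≤ (closeˣ j i (ℕ.≤-trans M≤i i≤j) M≤i)))
           (ℚ.*-monoˡ-≤-nonNeg (ι L) {{nonNegative (0≤ι L)}} (ℚ.<⇒≤ (closeʸ j i (ℕ.≤-trans N≤i i≤j) N≤i))) ⟩
        ι K * δ + ι L * δ ≡⟨ sym (ℚ.*-distribʳ-+ δ (ι K) (ι L)) ⟩
        (ι K + ι L) * δ ≡⟨ cong (_* δ) (sym (ι-+ K L)) ⟩
        ι (K ℕ.+ L) * δ <⟨ small ⟩
        ε ∎

  cauchy-+ : ∀ x y → Cauchy x → Cauchy y → Cauchy (λ i → x i + y i)
  cauchy-+ x y cx cy = cauchy-dominated x y (λ i → x i + y i) 1 1 cx cy λ i j _ → begin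
      ∣ (x j + y j) - (x i + y i) ∣
        ≡⟨ cong ∣_∣ (solve 4 (λ a b c d → (a :+ b) :- (c :+ d) := (a :- c) :+ (b :- d)) refl (x j) (y j) (x i) (y i)) ⟩
      ∣ (x j - x i) + (y j - y i) ∣ ≤⟨ ℚ.∣p+q∣≤∣p∣+∣q∣ (x j - x i) (y j - y i) ⟩
      ∣ x j - x i ∣ + ∣ y j - y i ∣ ≡⟨ sym (cong₂ _+_ (ℚ.*-identityˡ ∣ x j - x i ∣) (ℚ.*-identityˡ ∣ y j - y i ∣)) ⟩
      1ℚ * ∣ x j - x i ∣ + 1ℚ * ∣ y j - y i ∣ ∎
    where open ℚ.≤-Reasoning

  cauchy-* : ∀ x y → Cauchy x → Cauchy y → Cauchy (λ i → x i * y i)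
  cauchy-* x y cx cy with bounded x cx | bounded y cy
  ... | K , x≤ | L , y≤ = cauchy-dominated x y (λ i → x i * y i) (suc L) (suc K) cx cy λ i j _ → begin
      ∣ x j * y j - x i * y i ∣
        ≡⟨ cong ∣_∣ (solve 4 (λ a b c d → a :* b :- c :* d := b :* (a :- c) :+ c :* (b :- d)) refl (x j) (y j) (x i) (y i)) ⟩
      ∣ y j * (x j - x i) + x i * (y j - y i) ∣
        ≤⟨ ∣+∣≤ (y j * (x j - x i)) (x i * (y j - y i)) (∣*∣≤ (y j) (x j - x i) (y≤ j) ℚ.≤-refl) (∣*∣≤ (x i) (y j - y i) (x≤ i) ℚ.≤-refl) ⟩
      ι (suc L) * ∣ x j - x i ∣ + ι (suc K) * ∣ y j - y i ∣ ∎
    where open ℚ.≤-Reasoning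

  ∑< : ℕ → (ℕ → ℚ) → ℚ
  ∑< zero    t = 0ℚ
  ∑< (suc n) t = ∑< n t + t n

  ∑<-*ˡ : ∀ c t n → ∑< n (λ i → c * t i) ≡ c * ∑< n t
  ∑<-*ˡ c t zero    = sym (ℚ.*-zeroʳ c)
  ∑<-*ˡ c t (suc n) = trans (cong (_+ c * t n) (∑<-*ˡ c t n)) (sym (ℚ.*-distribˡ-+ c (∑< n t) (t n)))

  ∑<-- : ∀ t u n → ∑< n t - ∑< n u ≡ ∑< n (λ i → t i - u i)
  ∑<-- t u zero    = refl
  ∑<-- t u (suc n) = trans
    (solve 4 (λ a b c d → (a :+ b) :- (c :+ d) := (a :- c) :+ (b :- d)) refl (∑< n t) (t n) (∑< n u) (u n))
    (cong (_+ (t n - u n)) (∑<-- t u n))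

  ∑<-compare : ∀ t u → (∀ i → ∣ t i ∣ ≤ u i) → ∀ {m n} → m ℕ.≤′ n →
    ∣ ∑< n t - ∑< m t ∣ ≤ ∑< n u - ∑< m u
  ∑<-compare t u h {m} ℕ.≤′-refl = ℚ.≤-reflexive (begin
      ∣ ∑< m t - ∑< m t ∣ ≡⟨ cong ∣_∣ (ℚ.+-inverseʳ (∑< m t)) ⟩
      0ℚ                  ≡⟨ ℚ.+-inverseʳ (∑< m u) ⟨
      ∑< m u - ∑< m u     ∎)
    where open ≡-Reasoning
  ∑<-compare t u h {m} {suc n} (ℕ.≤′-step m≤n) = begin
      ∣ (∑< n t + t n) - ∑< m t ∣ ≡⟨ cong ∣_∣ (swap (∑< n t) (t n) (∑< m t)) ⟩
      ∣ (∑< n t - ∑< m t) + t n ∣ ≤⟨ ∣+∣≤ (∑< n t - ∑< m t) (t n) (∑<-compare t u h m≤n) (h n) ⟩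
      (∑< n u - ∑< m u) + u n     ≡⟨ swap (∑< n u) (u n) (∑< m u) ⟨
      (∑< n u + u n) - ∑< m u     ∎
    where
    open ℚ.≤-Reasoning
    swap : ∀ a b c → (a + b) - c ≡ (a - c) + b
    swap = solve 3 (λ a b c → (a :+ b) :- c := (a :- c) :+ b) refl

  p≤∣p∣ : ∀ p → p ≤ ∣ p ∣
  p≤∣p∣ p with ℚ.≤-total 0ℚ p
  ... | inj₁ 0≤p = ℚ.≤-reflexive (sym (ℚ.0≤p⇒∣p∣≡p 0≤p))
  ... | inj₂ p≤0 = ℚ.≤-trans p≤0 (ℚ.0≤∣p∣ p)

  0≤^ : ∀ {x} → 0ℚ ≤ x → ∀ n → 0ℚ ≤ x ^ n
  0≤^ 0≤x zero    = ℚ.<⇒≤ (ℚ.positive⁻¹ 1ℚ)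
  0≤^ 0≤x (suc n) = 0≤* 0≤x (0≤^ 0≤x n)

  module Geometric (p : ℕ) where

    q s : ℚ
    q = 1ℚ - recip (suc p)
    s = ι (suc p)

    s*q : s * q ≡ ι p
    s*q = begin
      s * (1ℚ - recip (suc p))   ≡⟨ solve 2 (λ s r → s :* (con 1ℚ :- r) := s :- s :* r) refl s (recip (suc p)) ⟩
      s - s * recip (suc p)      ≡⟨ cong₂ _-_ (ι-+ 1 p) (ι*recip (suc p)) ⟩
      (1ℚ + ι p) - 1ℚ            ≡⟨ solve 1 (λ a → (con 1ℚ :+ a) :- con 1ℚ := a) refl (ι p) ⟩
      ι p ∎
      where open ≡-Reasoning

    0≤q : 0ℚ ≤ q
    0≤q = ℚ.*-cancelˡ-≤-pos s {{positive (ι-mono-< {0} {suc p} (ℕ.s≤s ℕ.z≤n))}}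
      (subst₂ _≤_ (sym (ℚ.*-zeroʳ s)) (sym s*q) (0≤ι p))

    q≤1 : q ≤ 1ℚ
    q≤1 = ℚ.+-monoʳ-≤ 1ℚ (ℚ.neg-antimono-≤ (ℚ.<⇒≤ (0<recip (suc p))))

    0≤q^ : ∀ n → 0ℚ ≤ q ^ n
    0≤q^ = 0≤^ 0≤q

    q^≤1 : ∀ n → q ^ n ≤ 1ℚ
    q^≤1 zero    = ℚ.≤-refl
    q^≤1 (suc n) = *-mono 0≤q q≤1 (0≤q^ n) (q^≤1 n)

    n*q^n≤p : ∀ n → ι n * q ^ n ≤ ι p
    n*q^n≤p zero    = 0≤ι p
    n*q^n≤p (suc n) = begin
      ι (suc n) * (q * q ^ n)       ≡⟨ cong (_* (q * q ^ n)) (ι-+ 1 n) ⟩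
      (1ℚ + ι n) * (q * q ^ n)      ≡⟨ solve 3 (λ n q a → (con 1ℚ :+ n) :* (q :* a) := q :* (a :+ n :* a)) refl (ι n) q (q ^ n) ⟩
      q * (q ^ n + ι n * q ^ n)     ≤⟨ ℚ.*-monoˡ-≤-nonNeg q {{nonNegative 0≤q}} (ℚ.+-mono-≤ (q^≤1 n) (n*q^n≤p n)) ⟩
      q * (1ℚ + ι p)                ≡⟨ cong (q *_) (ι-+ 1 p) ⟨
      q * s                         ≡⟨ ℚ.*-comm q s ⟩
      s * q                         ≡⟨ s*q ⟩
      ι p ∎
      where open ℚ.≤-Reasoning

    G : ℕ → ℚ
    G n = ∑< n (q ^_)

    G≡ : ∀ n → G n ≡ s - s * q ^ n
    G≡ zero    = sym (solve 1 (λ s → s :- s :* con 1ℚ := con 0ℚ) refl s)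
    G≡ (suc n) = begin
      G n + q ^ n                      ≡⟨ cong (_+ q ^ n) (G≡ n) ⟩
      (s - s * q ^ n) + q ^ n          ≡⟨ solve 2 (λ s a → (s :- s :* a) :+ a := s :- (s :- con 1ℚ) :* a) refl s (q ^ n) ⟩
      s - (s - 1ℚ) * q ^ n             ≡⟨ cong (λ z → s - z * q ^ n) s-1 ⟩
      s - (s * q) * q ^ n              ≡⟨ cong (λ z → s - z) (ℚ.*-assoc s q (q ^ n)) ⟩
      s - s * (q * q ^ n)              ∎
      where
      open ≡-Reasoning
      s-1 : s - 1ℚ ≡ s * q
      s-1 = begin
        s - 1ℚ              ≡⟨ cong (_- 1ℚ) (ι-+ 1 p) ⟩
        (1ℚ + ι p) - 1ℚ     ≡⟨ solve 1 (λ a → (con 1ℚ :+ a) :- con 1ℚ := a) refl (ι p) ⟩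
        ι p                 ≡⟨ s*q ⟨
        s * q               ∎

    0≤s*q^ : ∀ n → 0ℚ ≤ s * q ^ n
    0≤s*q^ n = 0≤* (0≤ι (suc p)) (0≤q^ n)

    G≤s : ∀ n → G n ≤ s
    G≤s n = begin
      G n            ≡⟨ G≡ n ⟩
      s - s * q ^ n  ≤⟨ ℚ.+-monoʳ-≤ s (ℚ.neg-antimono-≤ (0≤s*q^ n)) ⟩
      s + 0ℚ         ≡⟨ ℚ.+-identityʳ s ⟩
      s              ∎
      where open ℚ.≤-Reasoning

    G-tail : ∀ {m n} → m ≤ⁿ n → ∣ G n - G m ∣ ≤ s * q ^ m
    G-tail {m} {n} m≤n = begin
      ∣ G n - G m ∣ ≤⟨ ∑<-compare (q ^_) (q ^_) (λ i → ℚ.≤-reflexive (ℚ.0≤p⇒∣p∣≡p (0≤q^ i))) (ℕ.≤⇒≤′ m≤n) ⟩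
      G n - G m     ≡⟨ cong₂ _-_ (G≡ n) (G≡ m) ⟩
      (s - s * q ^ n) - (s - s * q ^ m) ≡⟨ solve 3 (λ s a b → (s :- a) :- (s :- b) := b :- a) refl s (s * q ^ n) (s * q ^ m) ⟩
      s * q ^ m - s * q ^ n             ≤⟨ ℚ.+-monoʳ-≤ (s * q ^ m) (ℚ.neg-antimono-≤ (0≤s*q^ n)) ⟩
      s * q ^ m + 0ℚ                    ≡⟨ ℚ.+-identityʳ (s * q ^ m) ⟩
      s * q ^ m ∎
      where open ℚ.≤-Reasoning

    cauchy-G : Cauchy G
    cauchy-G = cauchy-≤ G λ ε 0<ε →
      let N , D<Nε = archimedean (suc p ℕ.* p) ε 0<ε
      in N , λ m n N≤m m≤n →
        let open ℚ.≤-Reasoning in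
        ℚ.*-cancelˡ-<-nonNeg (ι m) {{nonNegative (0≤ι m)}} (begin-strict
          ι m * ∣ G n - G m ∣  ≤⟨ ℚ.*-monoˡ-≤-nonNeg (ι m) {{nonNegative (0≤ι m)}} (G-tail m≤n) ⟩
          ι m * (s * q ^ m)    ≡⟨ solve 3 (λ m s a → m :* (s :* a) := s :* (m :* a)) refl (ι m) s (q ^ m) ⟩
          s * (ι m * q ^ m)    ≤⟨ ℚ.*-monoˡ-≤-nonNeg s {{nonNegative (0≤ι (suc p))}} (n*q^n≤p m) ⟩
          s * ι p              ≡⟨ ι-* (suc p) p ⟨
          ι (suc p ℕ.* p)      <⟨ D<Nε ⟩
          ι N * ε              ≤⟨ ℚ.*-monoʳ-≤-nonNeg ε {{nonNegative (ℚ.<⇒≤ 0<ε)}} (ι-mono-≤ N≤m) ⟩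
          ι m * ε              ∎)

    ∑<-geometric : ∀ t c → 0ℚ ≤ c → (∀ i → ∣ t i ∣ ≤ c * q ^ i) → ∀ {m n} → m ≤ⁿ n →
      ∣ ∑< n t - ∑< m t ∣ ≤ c * (G n - G m)
    ∑<-geometric t c 0≤c h {m} {n} m≤n = begin
      ∣ ∑< n t - ∑< m t ∣ ≤⟨ ∑<-compare t (λ i → c * q ^ i) h (ℕ.≤⇒≤′ m≤n) ⟩
      ∑< n (λ i → c * q ^ i) - ∑< m (λ i → c * q ^ i) ≡⟨ cong₂ _-_ (∑<-*ˡ c (q ^_) n) (∑<-*ˡ c (q ^_) m) ⟩
      c * G n - c * G m ≡⟨ solve 3 (λ c a b → c :* a :- c :* b := c :* (a :- b)) refl c (G n) (G m) ⟩
      c * (G n - G m) ∎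
      where open ℚ.≤-Reasoning

  log-term : ℕ → ℕ → ℚ
  log-term p i = (1ℚ - + 1 / suc p) ^ suc i * (+ 1 / suc i)

  recip≤1 : ∀ d .{{_ : ℕ.NonZero d}} → recip d ≤ 1ℚ
  recip≤1 (suc d) = begin
      recip (suc d)              ≡⟨ ℚ.*-identityˡ (recip (suc d)) ⟨
      1ℚ * recip (suc d)         ≤⟨ ℚ.*-monoʳ-≤-nonNeg (recip (suc d)) {{nonNegative (ℚ.<⇒≤ (0<recip (suc d)))}} (ι-mono-≤ {1} {suc d} (ℕ.s≤s ℕ.z≤n)) ⟩
      ι (suc d) * recip (suc d)  ≡⟨ ι*recip (suc d) ⟩
      1ℚ                         ∎
    where open ℚ.≤-Reasoning

  log-cauchy : ∀ p → Cauchy (λ n → ∑< n (log-term p))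
  log-cauchy p = cauchy-dominated G G (λ n → ∑< n (log-term p)) 1 0 cauchy-G cauchy-G λ i j i≤j →
      begin
      ∣ ∑< j (log-term p) - ∑< i (log-term p) ∣ ≤⟨ ∑<-geometric (log-term p) 1ℚ (0≤ι 1) bound i≤j ⟩
      1ℚ * (G j - G i)       ≤⟨ ℚ.*-monoˡ-≤-nonNeg 1ℚ (p≤∣p∣ (G j - G i)) ⟩
      1ℚ * ∣ G j - G i ∣     ≡⟨ solve 1 (λ a → con 1ℚ :* a := con 1ℚ :* a :+ con 0ℚ :* a) refl ∣ G j - G i ∣ ⟩
      1ℚ * ∣ G j - G i ∣ + 0ℚ * ∣ G j - G i ∣ ∎
    where
    open Geometric p
    open ℚ.≤-Reasoning
    bound : ∀ i → ∣ log-term p i ∣ ≤ 1ℚ * q ^ i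
    bound i = begin
      ∣ q ^ suc i * recip (suc i) ∣ ≡⟨ ℚ.0≤p⇒∣p∣≡p (0≤* (0≤q^ (suc i)) (ℚ.<⇒≤ (0<recip (suc i)))) ⟩
      q ^ suc i * recip (suc i)     ≤⟨ *-mono (0≤q^ (suc i)) (*-mono 0≤q q≤1 (0≤q^ i) ℚ.≤-refl) (ℚ.<⇒≤ (0<recip (suc i))) (recip≤1 (suc i)) ⟩
      1ℚ * q ^ i * 1ℚ               ≡⟨ ℚ.*-identityʳ (1ℚ * q ^ i) ⟩
      1ℚ * q ^ i ∎

  exp-term : (ℕ → ℚ) → ℚ → ℕ → ℚ
  exp-term c x i = c i * x ^ i * (+ 1 / (i !)) {{i ℕ.!≢0}}

  ι-^ : ∀ m n → ι (m ℕ.^ n) ≡ ι m ^ n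
  ι-^ m zero    = refl
  ι-^ m (suc n) = trans (ι-* m (m ℕ.^ n)) (cong (ι m *_) (ι-^ m n))

  ^-bound : ∀ {x K} → ∣ x ∣ ≤ K → ∀ n → ∣ x ^ n ∣ ≤ K ^ n
  ^-bound h zero    = ℚ.≤-refl
  ^-bound {x} h (suc n) = ∣*∣≤ x (x ^ n) h (^-bound h n)

  ^-increment : ∀ {x y} K → ∣ x ∣ ≤ ι (suc K) → ∣ y ∣ ≤ ι (suc K) → ∀ n →
    ∣ x ^ n - y ^ n ∣ ≤ ∣ x - y ∣ * (ι n * ι (suc K) ^ n)
  ^-increment {x} {y} K hx hy zero =
    ℚ.≤-reflexive (sym (trans (cong (∣ x - y ∣ *_) (ℚ.*-zeroˡ 1ℚ)) (ℚ.*-zeroʳ ∣ x - y ∣)))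
  ^-increment {x} {y} K hx hy (suc n) = begin
      ∣ x * x ^ n - y * y ^ n ∣
        ≡⟨ cong ∣_∣ (solve 4 (λ x y a b → x :* a :- y :* b := x :* (a :- b) :+ (x :- y) :* b) refl x y (x ^ n) (y ^ n)) ⟩
      ∣ x * (x ^ n - y ^ n) + (x - y) * y ^ n ∣
        ≤⟨ ∣+∣≤ (x * (x ^ n - y ^ n)) ((x - y) * y ^ n)
             (∣*∣≤ x (x ^ n - y ^ n) hx (^-increment K hx hy n))
             (∣*∣≤ (x - y) (y ^ n) ℚ.≤-refl (ℚ.≤-trans (^-bound hy n) P≤)) ⟩
      k * (d * (ι n * P)) + d * (k * P)
        ≡⟨ solve 4 (λ k d n P → k :* (d :* (n :* P)) :+ d :* (k :* P) := d :* ((con 1ℚ :+ n) :* (k :* P))) refl k d (ι n) P ⟩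
      d * ((1ℚ + ι n) * (k * P)) ≡⟨ cong (λ z → d * (z * (k * P))) (ι-+ 1 n) ⟨
      d * (ι (suc n) * (k * P)) ∎
    where
    open ℚ.≤-Reasoning
    k = ι (suc K)
    d = ∣ x - y ∣
    P = k ^ n
    P≤ : P ≤ k * P
    P≤ = subst (_≤ k * P) (ℚ.*-identityˡ P)
      (ℚ.*-monoʳ-≤-nonNeg P {{nonNegative (0≤^ (0≤ι (suc K)) n)}} (ι-mono-≤ {1} {suc K} (ℕ.s≤s ℕ.z≤n)))

  ^≤!-upto : ∀ M i → i ≤ⁿ suc M → suc M ℕ.^ i ≤ⁿ (suc M ℕ.^ suc M) ℕ.* i !
  ^≤!-upto M i i≤ = ℕ.≤-trans (ℕ.^-monoʳ-≤ (suc M) i≤)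
    (ℕ.m≤m*n (suc M ℕ.^ suc M) (i !) {{i ℕ.!≢0}})

  ^≤! : ∀ M i → suc M ℕ.^ i ≤ⁿ (suc M ℕ.^ suc M) ℕ.* i !
  ^≤! M zero = ^≤!-upto M 0 ℕ.z≤n
  ^≤! M (suc i) with ℕ.≤-total (suc i) (suc M)
  ... | inj₁ i≤M = ^≤!-upto M (suc i) i≤M
  ... | inj₂ M≤i = begin
      suc M ℕ.* suc M ℕ.^ i       ≤⟨ ℕ.*-mono-≤ M≤i (^≤! M i) ⟩
      suc i ℕ.* (C ℕ.* i !)       ≡⟨ ℕ.*-assoc (suc i) C (i !) ⟨
      suc i ℕ.* C ℕ.* i !         ≡⟨ cong (ℕ._* i !) (ℕ.*-comm (suc i) C) ⟩
      C ℕ.* suc i ℕ.* i !         ≡⟨ ℕ.*-assoc C (suc i) (i !) ⟩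
      C ℕ.* (suc i ℕ.* i !)       ∎
    where
    open ℕ.≤-Reasoning
    C = suc M ℕ.^ suc M

  ^-distrib-* : ∀ i m n → (m ℕ.* n) ℕ.^ i ≡ m ℕ.^ i ℕ.* n ℕ.^ i
  ^-distrib-* zero    m n = refl
  ^-distrib-* (suc i) m n = trans (cong (m ℕ.* n ℕ.*_) (^-distrib-* i m n))
    (ℕ.[m*n]*[o*p]≡[m*o]*[n*p] m n (m ℕ.^ i) (n ℕ.^ i))

  suc≤2^ : ∀ i → suc i ≤ⁿ 2 ℕ.^ i
  suc≤2^ zero    = ℕ.≤-refl
  suc≤2^ (suc i) = begin
      suc (suc i)              ≤⟨ ℕ.+-mono-≤ (ℕ.s≤s ℕ.z≤n) (suc≤2^ i) ⟩
      suc i ℕ.+ 2 ℕ.^ i        ≤⟨ ℕ.+-monoˡ-≤ (2 ℕ.^ i) (suc≤2^ i) ⟩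
      2 ℕ.^ i ℕ.+ 2 ℕ.^ i      ≡⟨ cong (2 ℕ.^ i ℕ.+_) (ℕ.+-identityʳ (2 ℕ.^ i)) ⟨
      2 ℕ.^ suc i ∎
    where open ℕ.≤-Reasoning

  open Geometric 1 using () renaming (q to half)

  exp-const : ℕ → ℕ
  exp-const K = (4 ℕ.* suc K) ℕ.^ (4 ℕ.* suc K)

  coefficient-boundⁿ : ∀ K i → (suc i ℕ.* suc K ℕ.^ i) ℕ.* 2 ℕ.^ i ≤ⁿ exp-const K ℕ.* i !
  coefficient-boundⁿ K i = begin
      (suc i ℕ.* suc K ℕ.^ i) ℕ.* 2 ℕ.^ i    ≤⟨ ℕ.*-monoˡ-≤ (2 ℕ.^ i) (ℕ.*-monoˡ-≤ (suc K ℕ.^ i) (suc≤2^ i)) ⟩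
      (2 ℕ.^ i ℕ.* suc K ℕ.^ i) ℕ.* 2 ℕ.^ i  ≡⟨ cong (ℕ._* 2 ℕ.^ i) (^-distrib-* i 2 (suc K)) ⟨
      (2 ℕ.* suc K) ℕ.^ i ℕ.* 2 ℕ.^ i        ≡⟨ ^-distrib-* i (2 ℕ.* suc K) 2 ⟨
      (2 ℕ.* suc K ℕ.* 2) ℕ.^ i              ≡⟨ cong (ℕ._^ i) (trans (ℕ.*-comm (2 ℕ.* suc K) 2) (sym (ℕ.*-assoc 2 2 (suc K)))) ⟩
      (4 ℕ.* suc K) ℕ.^ i                    ≤⟨ ^≤! (K ℕ.+ 3 ℕ.* suc K) i ⟩
      exp-const K ℕ.* i ! ∎
    where open ℕ.≤-Reasoning

  2^*half^ : ∀ i → ι (2 ℕ.^ i) * half ^ i ≡ 1ℚ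
  2^*half^ zero    = refl
  2^*half^ (suc i) = begin
      ι (2 ℕ.* 2 ℕ.^ i) * (half * half ^ i)    ≡⟨ cong (_* (half * half ^ i)) (ι-* 2 (2 ℕ.^ i)) ⟩
      ι 2 * ι (2 ℕ.^ i) * (half * half ^ i)    ≡⟨ solve 4 (λ a b c d → a :* b :* (c :* d) := a :* c :* (b :* d)) refl (ι 2) (ι (2 ℕ.^ i)) half (half ^ i) ⟩
      ι 2 * half * (ι (2 ℕ.^ i) * half ^ i)    ≡⟨ cong (ι 2 * half *_) (2^*half^ i) ⟩
      1ℚ ∎
    where open ≡-Reasoning

  recip! : ℕ → ℚ
  recip! i = recip (i !) {{i ℕ.!≢0}}

  0≤recip! : ∀ i → 0ℚ ≤ recip! i
  0≤recip! i = ℚ.<⇒≤ (0<recip (i !) {{i ℕ.!≢0}})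

  coefficient-bound : ∀ K i → ι (suc i) * ι (suc K) ^ i * recip! i ≤ ι (exp-const K) * half ^ i
  coefficient-bound K i = begin
      ι (suc i) * ι (suc K) ^ i * w     ≡⟨ cong (λ z → ι (suc i) * z * w) (ι-^ (suc K) i) ⟨
      ι (suc i) * ι (suc K ℕ.^ i) * w   ≡⟨ cong (_* w) (ι-* (suc i) (suc K ℕ.^ i)) ⟨
      ι A * w                           ≡⟨ ℚ.*-identityˡ (ι A * w) ⟨
      1ℚ * (ι A * w)                    ≡⟨ cong (_* (ι A * w)) (2^*half^ i) ⟨
      ι (2 ℕ.^ i) * h * (ι A * w)       ≡⟨ solve 4 (λ t h a w → t :* h :* (a :* w) := (a :* t) :* (h :* w)) refl (ι (2 ℕ.^ i)) h (ι A) w ⟩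
      ι A * ι (2 ℕ.^ i) * (h * w)       ≡⟨ cong (_* (h * w)) (ι-* A (2 ℕ.^ i)) ⟨
      ι (A ℕ.* 2 ℕ.^ i) * (h * w)       ≤⟨ ℚ.*-monoʳ-≤-nonNeg (h * w) {{nonNegative (0≤* (Geometric.0≤q^ 1 i) (0≤recip! i))}} (ι-mono-≤ (coefficient-boundⁿ K i)) ⟩
      ι (exp-const K ℕ.* i !) * (h * w) ≡⟨ cong (_* (h * w)) (ι-* (exp-const K) (i !)) ⟩
      ι (exp-const K) * ι (i !) * (h * w) ≡⟨ solve 4 (λ c f h w → c :* f :* (h :* w) := c :* h :* (f :* w)) refl (ι (exp-const K)) (ι (i !)) h w ⟩
      ι (exp-const K) * h * (ι (i !) * w) ≡⟨ cong (ι (exp-const K) * h *_) (ι*recip (i !) {{i ℕ.!≢0}}) ⟩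
      ι (exp-const K) * h * 1ℚ            ≡⟨ ℚ.*-identityʳ (ι (exp-const K) * h) ⟩
      ι (exp-const K) * h ∎
    where
    open ℚ.≤-Reasoning
    w = recip! i
    h = half ^ i
    A = suc i ℕ.* suc K ℕ.^ i

  module _ (c : ℕ → ℚ) (c≤1 : ∀ i → ∣ c i ∣ ≤ 1ℚ) (K : ℕ) where
    private
      C = exp-const K
      k = ι (suc K)
      open Geometric 1 using (G; G≤s; cauchy-G; ∑<-geometric)

    exp-term-bound : ∀ {x} → ∣ x ∣ ≤ k → ∀ i → ∣ exp-term c x i ∣ ≤ ι C * half ^ i
    exp-term-bound {x} hx i = begin
      ∣ c i * x ^ i * recip! i ∣      ≤⟨ ∣*∣≤ (c i * x ^ i) (recip! i) (∣*∣≤ (c i) (x ^ i) (c≤1 i) (^-bound hx i)) (ℚ.≤-reflexive (ℚ.0≤p⇒∣p∣≡p (0≤recip! i))) ⟩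
      1ℚ * k ^ i * recip! i           ≤⟨ ℚ.*-monoʳ-≤-nonNeg (recip! i) {{nonNegative (0≤recip! i)}}
                                           (ℚ.*-monoʳ-≤-nonNeg (k ^ i) {{nonNegative (0≤^ (0≤ι (suc K)) i)}} (ι-mono-≤ {1} {suc i} (ℕ.s≤s ℕ.z≤n))) ⟩
      ι (suc i) * k ^ i * recip! i    ≤⟨ coefficient-bound K i ⟩
      ι C * half ^ i ∎
      where open ℚ.≤-Reasoning

    exp-term-increment : ∀ {x y} → ∣ x ∣ ≤ k → ∣ y ∣ ≤ k → ∀ i →
      ∣ exp-term c x i - exp-term c y i ∣ ≤ ∣ x - y ∣ * ι C * half ^ i
    exp-term-increment {x} {y} hx hy i = begin
      ∣ c i * x ^ i * recip! i - c i * y ^ i * recip! i ∣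
        ≡⟨ cong ∣_∣ (solve 4 (λ c a b w → c :* a :* w :- c :* b :* w := c :* (a :- b) :* w) refl (c i) (x ^ i) (y ^ i) (recip! i)) ⟩
      ∣ c i * (x ^ i - y ^ i) * recip! i ∣
        ≤⟨ ∣*∣≤ (c i * (x ^ i - y ^ i)) (recip! i) (∣*∣≤ (c i) (x ^ i - y ^ i) (c≤1 i) (^-increment K hx hy i))
             (ℚ.≤-reflexive (ℚ.0≤p⇒∣p∣≡p (0≤recip! i))) ⟩
      1ℚ * (d * (ι i * k ^ i)) * recip! i
        ≡⟨ solve 4 (λ d n P w → con 1ℚ :* (d :* (n :* P)) :* w := d :* (n :* P :* w)) refl d (ι i) (k ^ i) (recip! i) ⟩
      d * (ι i * k ^ i * recip! i)
        ≤⟨ ℚ.*-monoˡ-≤-nonNeg d {{nonNegative (ℚ.0≤∣p∣ (x - y))}}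
            (ℚ.*-monoʳ-≤-nonNeg (recip! i) {{nonNegative (0≤recip! i)}}
              (ℚ.*-monoʳ-≤-nonNeg (k ^ i) {{nonNegative (0≤^ (0≤ι (suc K)) i)}} (ι-mono-≤ (ℕ.n≤1+n i)))) ⟩
      d * (ι (suc i) * k ^ i * recip! i)
        ≤⟨ ℚ.*-monoˡ-≤-nonNeg d {{nonNegative (ℚ.0≤∣p∣ (x - y))}} (coefficient-bound K i) ⟩
      d * (ι C * half ^ i) ≡⟨ ℚ.*-assoc d (ι C) (half ^ i) ⟨
      d * ι C * half ^ i ∎
      where
      open ℚ.≤-Reasoning
      d = ∣ x - y ∣

    exp-sum-increment : ∀ {x y} → ∣ x ∣ ≤ k → ∣ y ∣ ≤ k → ∀ n →
      ∣ ∑< n (exp-term c x) - ∑< n (exp-term c y) ∣ ≤ ι (C ℕ.* 2) * ∣ x - y ∣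
    exp-sum-increment {x} {y} hx hy n = begin
      ∣ ∑< n (exp-term c x) - ∑< n (exp-term c y) ∣ ≡⟨ cong ∣_∣ (∑<-- (exp-term c x) (exp-term c y) n) ⟩
      ∣ ∑< n t ∣             ≡⟨ cong ∣_∣ (ℚ.+-identityʳ (∑< n t)) ⟨
      ∣ ∑< n t - ∑< 0 t ∣    ≤⟨ ∑<-geometric t (d * ι C) (0≤* (ℚ.0≤∣p∣ (x - y)) (0≤ι C)) (exp-term-increment hx hy) {0} {n} ℕ.z≤n ⟩
      d * ι C * (G n - 0ℚ)   ≡⟨ cong (d * ι C *_) (ℚ.+-identityʳ (G n)) ⟩
      d * ι C * G n          ≤⟨ ℚ.*-monoˡ-≤-nonNeg (d * ι C) {{nonNegative (0≤* (ℚ.0≤∣p∣ (x - y)) (0≤ι C))}} (G≤s n) ⟩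
      d * ι C * ι 2          ≡⟨ solve 3 (λ d c t → d :* c :* t := c :* t :* d) refl d (ι C) (ι 2) ⟩
      ι C * ι 2 * d          ≡⟨ cong (_* d) (ι-* C 2) ⟨
      ι (C ℕ.* 2) * d ∎
      where
      open ℚ.≤-Reasoning
      d = ∣ x - y ∣
      t = λ i → exp-term c x i - exp-term c y i

    exp-diagonal-cauchy : ∀ x → Cauchy x → (∀ i → ∣ x i ∣ ≤ k) → Cauchy (λ n → ∑< n (exp-term c (x n)))
    exp-diagonal-cauchy x cx hx = cauchy-dominated x G (λ n → ∑< n (exp-term c (x n))) (C ℕ.* 2) C cx cauchy-G λ i j i≤j →
      let open ℚ.≤-Reasoning
          T = λ a b → ∑< a (exp-term c (x b))
      in begin
      ∣ T j j - T i i ∣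
        ≡⟨ cong ∣_∣ (solve 3 (λ a b c → a :- c := (b :- c) :+ (a :- b)) refl (T j j) (T i j) (T i i)) ⟩
      ∣ (T i j - T i i) + (T j j - T i j) ∣
        ≤⟨ ∣+∣≤ (T i j - T i i) (T j j - T i j) (exp-sum-increment (hx j) (hx i) i)
             (ℚ.≤-trans (∑<-geometric (exp-term c (x j)) (ι C) (0≤ι C) (exp-term-bound (hx j)) i≤j)
               (ℚ.*-monoˡ-≤-nonNeg (ι C) {{nonNegative (0≤ι C)}} (p≤∣p∣ (G j - G i)))) ⟩
      ι (C ℕ.* 2) * ∣ x j - x i ∣ + ι C * ∣ G j - G i ∣ ∎

  exp-cauchy : ∀ c → (∀ i → ∣ c i ∣ ≤ 1ℚ) → ∀ x → Cauchy x → Cauchy (λ n → ∑< n (exp-term c (x n)))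
  exp-cauchy c c≤1 x cx with bounded x cx
  ... | K , hx = exp-diagonal-cauchy c c≤1 K x cx hx

  infixl 6 _+ᴿ_ _-ᴿ_
  infixl 7 _*ᴿ_

  fromℚ : ℚ → ℝ
  fromℚ q = mkℝ (λ _ → q) (cauchy-const q)

  negᴿ : ℝ → ℝ
  negᴿ x = mkℝ (λ n → - seq x n) (cauchy-neg (seq x) (cauchy x))

  _+ᴿ_ _*ᴿ_ _-ᴿ_ : ℝ → ℝ → ℝ
  x +ᴿ y = mkℝ (λ n → seq x n + seq y n) (cauchy-+ (seq x) (seq y) (cauchy x) (cauchy y))
  x *ᴿ y = mkℝ (λ n → seq x n * seq y n) (cauchy-* (seq x) (seq y) (cauchy x) (cauchy y))
  x -ᴿ y = x +ᴿ negᴿ y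

  -- The real number Σ_i c_i x^i / i!.  The partial sums are taken along the diagonal: the n-th
  -- approximation is the n-th partial sum evaluated at the n-th approximation of x.
  expSeries : (c : ℕ → ℚ) → (∀ i → ∣ c i ∣ ≤ 1ℚ) → ℝ → ℝ
  expSeries c c≤1 x = mkℝ (λ n → ∑< n (exp-term c (seq x n))) (exp-cauchy c c≤1 (seq x) (cauchy x))

  cos-coeff sin-coeff : ℕ → ℚ
  cos-coeff 0             = 1ℚ
  cos-coeff 1             = 0ℚ
  cos-coeff (suc (suc i)) = - cos-coeff i
  sin-coeff 0             = 0ℚ
  sin-coeff 1             = 1ℚ
  sin-coeff (suc (suc i)) = - sin-coeff i

  cos-coeff≤1 : ∀ i → ∣ cos-coeff i ∣ ≤ 1ℚ
  cos-coeff≤1 0             = ℚ.≤-refl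
  cos-coeff≤1 1             = 0≤ι 1
  cos-coeff≤1 (suc (suc i)) = subst (_≤ 1ℚ) (sym (ℚ.∣-p∣≡∣p∣ (cos-coeff i))) (cos-coeff≤1 i)

  sin-coeff≤1 : ∀ i → ∣ sin-coeff i ∣ ≤ 1ℚ
  sin-coeff≤1 0             = 0≤ι 1
  sin-coeff≤1 1             = ℚ.≤-refl
  sin-coeff≤1 (suc (suc i)) = subst (_≤ 1ℚ) (sym (ℚ.∣-p∣≡∣p∣ (sin-coeff i))) (sin-coeff≤1 i)

  expᴿ cosᴿ sinᴿ : ℝ → ℝ
  expᴿ = expSeries (λ _ → 1ℚ) (λ _ → ℚ.≤-refl)
  cosᴿ = expSeries cos-coeff cos-coeff≤1
  sinᴿ = expSeries sin-coeff sin-coeff≤1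

  -- log (1 + p), as - log (1 - y) = Σ_{i ≥ 1} y^i / i at y = 1 - 1 / (1 + p) ∈ [0 , 1).
  log-suc : ℕ → ℝ
  log-suc p = mkℝ (λ n → ∑< n (log-term p)) (log-cauchy p)

open Real public using (ℝ; seq; cauchy; mkℝ; _≈ᴿ_; _+ᴿ_; _-ᴿ_; _*ᴿ_; negᴿ; fromℚ; expᴿ; cosᴿ; sinᴿ; log-suc)

record ℂ : Set where
  constructor _+i_
  field
    re im : ℝ
open ℂ public

ℂ-rawRing : RawRing 0ℓ 0ℓ
ℂ-rawRing = record
  { Carrier = ℂ
  ; _≈_     = λ z w → (re z ≈ᴿ re w) × (im z ≈ᴿ im w)
  ; _+_     = λ z w → (re z +ᴿ re w) +i (im z +ᴿ im w)
  ; _*_     = λ z w → (re z *ᴿ re w -ᴿ im z *ᴿ im w) +i (re z *ᴿ im w +ᴿ im z *ᴿ re w)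
  ; -_      = λ z → negᴿ (re z) +i negᴿ (im z)
  ; 0#      = fromℚ 0ℚ +i fromℚ 0ℚ
  ; 1#      = fromℚ 1ℚ +i fromℚ 0ℚ
  }

open RawRing ℂ-rawRing public using (_≈_; _+_; _*_; -_; 0#; 1#)
open RawSemiringDefs (RawRing.rawSemiring ℂ-rawRing) public using (_^_) renaming (_×_ to _·_)

exp : ℂ → ℂ
exp (x +i y) = (expᴿ x *ᴿ cosᴿ y) +i (expᴿ x *ᴿ sinᴿ y)

-- m ^ᶜ k = e^(k log m) for m positive; the value at m = 0 is a junk value.
infixr 8 _^ᶜ_
_^ᶜ_ : ℕ → ℂ → ℂ
zero  ^ᶜ k = 0#
suc p ^ᶜ k = exp (k * (log-suc p +i fromℚ 0ℚ))

∑ : {A : Set} → List A → (A → ℂ) → ℂ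
∑ xs f = foldr (λ x s → f x + s) 0# xs

infix 5 ∑
syntax ∑ xs (λ x → e) = ∑[ x ∈ xs ] e

[1⋯_] : ℕ → List ℕ
[1⋯ n ] = applyUpTo suc n

record IsPartition (n : ℕ) (π : List ℕ) : Set where
  field
    decreasing : Linked ℕ._≥_ π
    positive   : All (0 ℕ.<_) π
    total      : sum π ≡ n

-- The partitions of n with at most l parts, each at most m.
boundedPartitions : (l m n : ℕ) → List (List ℕ)
boundedPartitions l       m zero    = [ [] ]
boundedPartitions zero    m (suc n) = []
boundedPartitions (suc l) m (suc n) =
  concatMap (λ a → map (suc a ∷_) (boundedPartitions l (suc a) (n ℕ.∸ a))) (upTo (m ℕ.⊓ suc n))

𝒫 : ℕ → List (List ℕ)
𝒫 n = boundedPartitions n n n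

𝒟 : ℕ → List (List ℕ)
𝒟 n = filter unique? (𝒫 n)

branch : (l n a : ℕ) → List (List ℕ)
branch l n a = map (suc a ∷_) (boundedPartitions l (suc a) (n ℕ.∸ a))

bounded-sound : ∀ l m n {π} → π ∈ boundedPartitions l m n → IsPartition n π × All (ℕ._≤ m) π
bounded-sound l       m zero    (here refl) = record { decreasing = [] ; positive = [] ; total = refl } , []
bounded-sound (suc l) m (suc n) π∈
  with a , a∈ , π∈a ← find (∈-concatMap⁻ (branch l n) {xs = upTo (m ℕ.⊓ suc n)} π∈)
  with ρ , ρ∈ , refl ← ∈-map⁻ (suc a ∷_) π∈a
  with record { decreasing = ↘ ; positive = pos ; total = refl⁻ } , ≤a ← bounded-sound l (suc a) (n ℕ.∸ a) ρ∈
  = record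
    { decreasing = ≤a ∷ᴸ ↘
    ; positive   = ℕ.s≤s ℕ.z≤n ∷ pos
    ; total      = cong suc (trans (cong (a ℕ.+_) refl⁻) (ℕ.m+[n∸m]≡n a≤n))
    }
  , a<m ∷ All.map (λ h → ℕ.≤-trans h a<m) ≤a
  where
  a<⊓ = ∈-upTo⁻ a∈
  a<m = ℕ.≤-trans a<⊓ (ℕ.m⊓n≤m m (suc n))
  a≤n = ℕ.s≤s⁻¹ (ℕ.≤-trans a<⊓ (ℕ.m⊓n≤n m (suc n)))
  _∷ᴸ_ : ∀ {x xs} → All (ℕ._≤ x) xs → Linked ℕ._≥_ xs → Linked ℕ._≥_ (x ∷ xs)
  []      ∷ᴸ _ = [-]
  (h ∷ _) ∷ᴸ ↘ = h ∷ ↘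

bounded-complete : ∀ l m {π} → Linked ℕ._≥_ π → All (0 ℕ.<_) π → All (ℕ._≤ m) π → length π ℕ.≤ l →
  π ∈ boundedPartitions l m (sum π)
bounded-complete l       m {[]}        _ _ _ _ = here refl
bounded-complete (suc l) m {suc a ∷ ρ} ↘ (_ ∷ pos) (a<m ∷ _) (ℕ.s≤s ≤l) =
  ∈-concatMap⁺ (branch l (a ℕ.+ sum ρ))
    (lose (∈-upTo⁺ (ℕ.⊓-glb a<m (ℕ.s≤s (ℕ.m≤m+n a (sum ρ)))))
      (∈-map⁺ (suc a ∷_)
        (subst (λ t → ρ ∈ boundedPartitions l (suc a) t) (sym (ℕ.m+n∸m≡n a (sum ρ)))
          (bounded-complete l (suc a) (Linked.tail ↘) pos (heads ↘) ≤l))))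
  where
  heads : ∀ {x xs} → Linked ℕ._≥_ (x ∷ xs) → All (ℕ._≤ x) xs
  heads [-]     = []
  heads (h ∷ t) = Linked.Linked⇒All (λ p q → ℕ.≤-trans q p) h t

bounded-unique : ∀ l m n → Unique (boundedPartitions l m n)
bounded-unique l       m zero    = [] ∷ []
bounded-unique zero    m (suc n) = []
bounded-unique (suc l) m (suc n) = Unique.concat⁺
  (All.map⁺ (All.tabulate λ {a} _ → Unique.map⁺ List.∷-injectiveʳ (bounded-unique l (suc a) (n ℕ.∸ a))))
  (AllPairs.map⁺ (AllPairs.map disjoint (Unique.upTo⁺ (m ℕ.⊓ suc n))))
  where
  disjoint : ∀ {a b} → a ≢ b → ∀ {π} → ¬ (π ∈ branch l n a × π ∈ branch l n b)
  disjoint a≢b (∈a , ∈b)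
    with _ , _ , refl ← ∈-map⁻ _ ∈a | _ , _ , eq ← ∈-map⁻ _ ∈b
    = a≢b (ℕ.suc-injective (List.∷-injectiveˡ eq))

length≤sum : ∀ {π} → All (0 ℕ.<_) π → length π ℕ.≤ sum π
length≤sum []        = ℕ.z≤n
length≤sum (p ∷ pos) = ℕ.+-mono-≤ p (length≤sum pos)

parts≤sum : ∀ π → All (ℕ._≤ sum π) π
parts≤sum []      = []
parts≤sum (x ∷ π) = ℕ.m≤m+n x (sum π) ∷ All.map (λ h → ℕ.≤-trans h (ℕ.m≤n+m (sum π) x)) (parts≤sum π)

∈-𝒫 : ∀ n {π} → π ∈ 𝒫 n ⇔ IsPartition n π
∈-𝒫 n {π} = mk⇔ (λ π∈ → proj₁ (bounded-sound n n n π∈))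
  λ { record { decreasing = ↘ ; positive = pos ; total = refl } →
      bounded-complete (sum π) (sum π) ↘ pos (parts≤sum π) (length≤sum pos) }

𝒫-unique : ∀ n → Unique (𝒫 n)
𝒫-unique n = bounded-unique n n n

-- The values at [] are junk values.  Since ν π ≤ ℓ π for a partition π, the truncated subtraction
-- ℓ π ∸ j is exact and positive for j < ν π.
smallest ℓ ν : List ℕ → ℕ
smallest []      = 0
smallest (x ∷ π) = min x π
ℓ π = max 0 π
ν π = length (deduplicate ℕ._≟_ π)

σ : ℂ → ℂ → ℕ → ℂ
σ k c n = ∑[ d ∈ filter (_∣? n) [1⋯ n ] ] (d ^ᶜ k * c ^ d)

{-# OPTIONS --safe #-}

module Submission where

-- Every sum in the theorem is taken entrywise in the approximating sequences, so it is enough to prove,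
-- for an arbitrary f : ℕ → ℚ in place of j ↦ jᵏ cʲ, the identity of rational combinations of the values
-- of f.  Compare the coefficients of f (m + 1), as power series in q.  On the distinct side it is
-- 1 - ∏_{i > m} (1 - qⁱ).  On the other side the partitions with ν = 1 account for σ, and those with
-- largest part M + 1 contribute q^{M+1} X M (M - m), where X M j is the coefficient of xʲ in
-- ∏_{i ≤ M} (1 - x qⁱ)/(1 - qⁱ), divided by 1 - q^{M+1}.  Both coefficients satisfy
-- y m = y (m + 1) + q^{m+1} (1 - y (m + 1)): for the distinct side this splits off the part m + 1, for
-- the other side it follows from the q-binomial recursion (1 - qʲ) X M j = (q^{M+1} - qʲ) X M (j - 1)
-- and a telescoping of the diagonal sum of X (M + j) j.

open import Data.Bool.Base using (if_then_else_)
open import Data.List.Base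
  using (List; []; _∷_; _++_; map; concatMap; foldr; filter; length; upTo; applyUpTo; deduplicate)
import Data.List.Extrema.Nat as Extrema
open import Data.List.Membership.Propositional using (_∈_)
import Data.List.Properties as List
open import Data.List.Relation.Unary.All as All using (All; []; _∷_; all?)
import Data.List.Relation.Unary.All.Properties as All
open import Data.List.Relation.Unary.AllPairs using ([]; _∷_)
open import Data.List.Relation.Unary.Any using (here; there)
import Data.List.Relation.Unary.Unique.DecPropositional
open import Data.Nat.Base using (ℕ; zero; suc; NonZero; _∸_; _≤_; _<_; z≤n; s≤s; _⊓_)
import Data.Nat.Base as ℕ
open import Data.Nat.Combinatorics using (_C_; k>n⇒nCk≡0; nCn≡1; nCk≡nC[n∸k]; nCk+nC[k+1]≡[n+1]C[k+1])
open import Data.Nat.Divisibility using (_∣?_; ∣⇒≤; ∣-refl; ∣m∣n⇒∣m+n; ∣m+n∣m⇒∣n; _∣0)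
open import Data.Nat.Induction using (<-rec)
import Data.Nat.Properties as ℕ
open import Data.Nat.Properties using (_≤?_; _<?_)
open import Data.Product.Base using (_×_; _,_; proj₁; proj₂; ∃-syntax)
open import Data.Rational.Base as ℚ using (ℚ; 0ℚ; 1ℚ)
import Data.Rational.Properties as ℚ
open import Data.Rational.Solver using (module +-*-Solver)
open import Data.Sum.Base using (inj₁; inj₂)
open import Function.Base using (_∘_)
open import Function.Bundles using (_⇔_; mk⇔; Equivalence)
open import Relation.Binary.PropositionalEquality
  using (_≡_; _≗_; refl; sym; trans; cong; cong₂; subst; module ≡-Reasoning)
open import Relation.Nullary.Decidable using (Dec; does; yes; no; does-⇔; dec-true; dec-false; ¬?)
open import Relation.Nullary.Negation using (¬_; contradiction)

open import Defs using (module Real; IsPartition; boundedPartitions; bounded-sound; length≤sum; 𝒫; 𝒟; smallest; ℓ; ν; [1⋯_])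
open Real using (∑<; ∑<-*ˡ; ∑<--; ι; ι-+)
open Data.List.Relation.Unary.Unique.DecPropositional ℕ._≟_ using (unique?)
open +-*-Solver using (solve; _:+_; _:*_; _:-_; :-_; _:=_; con)
open ≡-Reasoning

module RationalIdentity where

  open import Data.Rational.Base using (_+_; _*_; _-_; -_)

  -- Finite sums

  ∑<-cong : ∀ n {t u : ℕ → ℚ} → (∀ i → i < n → t i ≡ u i) → ∑< n t ≡ ∑< n u
  ∑<-cong zero    h = refl
  ∑<-cong (suc n) h = cong₂ _+_ (∑<-cong n (λ i i<n → h i (ℕ.m<n⇒m<1+n i<n))) (h n (ℕ.n<1+n n))

  ∑<-zero : ∀ n {t : ℕ → ℚ} → (∀ i → i < n → t i ≡ 0ℚ) → ∑< n t ≡ 0ℚ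
  ∑<-zero zero    h = refl
  ∑<-zero (suc n) h = trans
    (cong₂ _+_ (∑<-zero n (λ i i<n → h i (ℕ.m<n⇒m<1+n i<n))) (h n (ℕ.n<1+n n)))
    (ℚ.+-identityʳ 0ℚ)

  ∑<-+ : ∀ n (t u : ℕ → ℚ) → ∑< n (λ i → t i + u i) ≡ ∑< n t + ∑< n u
  ∑<-+ zero    t u = refl
  ∑<-+ (suc n) t u = trans (cong (_+ (t n + u n)) (∑<-+ n t u))
    (solve 4 (λ a b c d → (a :+ b) :+ (c :+ d) := (a :+ c) :+ (b :+ d)) refl
      (∑< n t) (∑< n u) (t n) (u n))

  ∑<-*ʳ : ∀ n (t : ℕ → ℚ) c → ∑< n (λ i → t i * c) ≡ ∑< n t * c
  ∑<-*ʳ n t c = begin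
    ∑< n (λ i → t i * c) ≡⟨ ∑<-cong n (λ i _ → ℚ.*-comm (t i) c) ⟩
    ∑< n (λ i → c * t i) ≡⟨ ∑<-*ˡ c t n ⟩
    c * ∑< n t           ≡⟨ ℚ.*-comm c (∑< n t) ⟩
    ∑< n t * c ∎

  ∑<-swap : ∀ m n (t : ℕ → ℕ → ℚ) →
    ∑< m (λ i → ∑< n (t i)) ≡ ∑< n (λ j → ∑< m (λ i → t i j))
  ∑<-swap zero    n t = sym (∑<-zero n (λ _ _ → refl))
  ∑<-swap (suc m) n t = trans (cong (_+ ∑< n (t m)) (∑<-swap m n t))
    (sym (∑<-+ n (λ j → ∑< m (λ i → t i j)) (t m)))

  ∑<-head : ∀ n (t : ℕ → ℚ) → ∑< (suc n) t ≡ t 0 + ∑< n (t ∘ suc)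
  ∑<-head zero    t = ℚ.+-comm 0ℚ (t 0)
  ∑<-head (suc n) t = trans (cong (_+ t (suc n)) (∑<-head n t)) (ℚ.+-assoc (t 0) (∑< n (t ∘ suc)) (t (suc n)))

  ∑<-append : ∀ m n (t : ℕ → ℚ) → ∑< (n ℕ.+ m) t ≡ ∑< m t + ∑< n (λ i → t (i ℕ.+ m))
  ∑<-append m zero    t = sym (ℚ.+-identityʳ (∑< m t))
  ∑<-append m (suc n) t = trans (cong (_+ t (n ℕ.+ m)) (∑<-append m n t))
    (ℚ.+-assoc (∑< m t) (∑< n (λ i → t (i ℕ.+ m))) (t (n ℕ.+ m)))

  ∑<-extend : ∀ {m n} {t : ℕ → ℚ} → m ≤ n → (∀ i → m ≤ i → t i ≡ 0ℚ) → ∑< n t ≡ ∑< m t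
  ∑<-extend {m} {n} {t} m≤n h = begin
    ∑< n t                                        ≡⟨ cong (λ x → ∑< x t) (ℕ.m∸n+n≡m m≤n) ⟨
    ∑< (n ∸ m ℕ.+ m) t                            ≡⟨ ∑<-append m (n ∸ m) t ⟩
    ∑< m t + ∑< (n ∸ m) (λ i → t (i ℕ.+ m))       ≡⟨ cong (∑< m t +_) (∑<-zero (n ∸ m) (λ i _ → h (i ℕ.+ m) (ℕ.m≤n+m m i))) ⟩
    ∑< m t + 0ℚ                                   ≡⟨ ℚ.+-identityʳ (∑< m t) ⟩
    ∑< m t ∎

  ∑<-translate : ∀ n j {t : ℕ → ℚ} → (∀ i → i < j → t i ≡ 0ℚ) → (∀ i → n ≤ i → t i ≡ 0ℚ) →
    ∑< n t ≡ ∑< n (λ i → t (i ℕ.+ j))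
  ∑<-translate n j {t} below above = begin
    ∑< n t                               ≡⟨ ∑<-extend (ℕ.m≤m+n n j) above ⟨
    ∑< (n ℕ.+ j) t                       ≡⟨ ∑<-append j n t ⟩
    ∑< j t + ∑< n (λ i → t (i ℕ.+ j))    ≡⟨ cong (_+ ∑< n (λ i → t (i ℕ.+ j))) (∑<-zero j below) ⟩
    0ℚ + ∑< n (λ i → t (i ℕ.+ j))        ≡⟨ ℚ.+-identityˡ _ ⟩
    ∑< n (λ i → t (i ℕ.+ j)) ∎

  -- Indicators and sums over lists

  ⟦_⟧ : {P : Set} → Dec P → ℚ
  ⟦ P? ⟧ = if does P? then 1ℚ else 0ℚ

  ⟦⟧-cong : ∀ {P Q : Set} {P? : Dec P} {Q? : Dec Q} → P ⇔ Q → ⟦ P? ⟧ ≡ ⟦ Q? ⟧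
  ⟦⟧-cong {P? = P?} {Q?} P⇔Q = cong (if_then 1ℚ else 0ℚ) (does-⇔ P⇔Q P? Q?)

  ⟦⟧-true : ∀ {P : Set} (P? : Dec P) → P → ⟦ P? ⟧ ≡ 1ℚ
  ⟦⟧-true P? p = cong (if_then 1ℚ else 0ℚ) (dec-true P? p)

  ⟦⟧-false : ∀ {P : Set} (P? : Dec P) → ¬ P → ⟦ P? ⟧ ≡ 0ℚ
  ⟦⟧-false P? ¬p = cong (if_then 1ℚ else 0ℚ) (dec-false P? ¬p)

  ∑ˡ : {A : Set} → List A → (A → ℚ) → ℚ
  ∑ˡ xs w = foldr (λ x s → w x + s) 0ℚ xs

  module _ {A : Set} where

    ∑ˡ-cong : ∀ {w v : A → ℚ} xs → (∀ {x} → x ∈ xs → w x ≡ v x) → ∑ˡ xs w ≡ ∑ˡ xs v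
    ∑ˡ-cong []       h = refl
    ∑ˡ-cong (x ∷ xs) h = cong₂ _+_ (h (here refl)) (∑ˡ-cong xs (h ∘ there))

    ∑ˡ-zero : ∀ (xs : List A) → ∑ˡ xs (λ _ → 0ℚ) ≡ 0ℚ
    ∑ˡ-zero []       = refl
    ∑ˡ-zero (x ∷ xs) = trans (ℚ.+-identityˡ _) (∑ˡ-zero xs)

    ∑ˡ-++ : ∀ (w : A → ℚ) xs ys → ∑ˡ (xs ++ ys) w ≡ ∑ˡ xs w + ∑ˡ ys w
    ∑ˡ-++ w []       ys = sym (ℚ.+-identityˡ (∑ˡ ys w))
    ∑ˡ-++ w (x ∷ xs) ys = trans (cong (w x +_) (∑ˡ-++ w xs ys)) (sym (ℚ.+-assoc (w x) (∑ˡ xs w) (∑ˡ ys w)))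

    ∑ˡ-map : ∀ {B : Set} (w : A → ℚ) (f : B → A) xs → ∑ˡ (map f xs) w ≡ ∑ˡ xs (w ∘ f)
    ∑ˡ-map w f []       = refl
    ∑ˡ-map w f (x ∷ xs) = cong (w (f x) +_) (∑ˡ-map w f xs)

    ∑ˡ-concatMap : ∀ {B : Set} (w : A → ℚ) (f : B → List A) xs →
      ∑ˡ (concatMap f xs) w ≡ ∑ˡ xs (λ x → ∑ˡ (f x) w)
    ∑ˡ-concatMap w f []       = refl
    ∑ˡ-concatMap w f (x ∷ xs) = trans (∑ˡ-++ w (f x) (concatMap f xs)) (cong (∑ˡ (f x) w +_) (∑ˡ-concatMap w f xs))

    ∑ˡ-applyUpTo : ∀ (w : A → ℚ) (f : ℕ → A) n → ∑ˡ (applyUpTo f n) w ≡ ∑< n (w ∘ f)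
    ∑ˡ-applyUpTo w f zero    = refl
    ∑ˡ-applyUpTo w f (suc n) = trans (cong (w (f 0) +_) (∑ˡ-applyUpTo w (f ∘ suc) n)) (sym (∑<-head n (w ∘ f)))

    ∑ˡ-filter : ∀ {P : A → Set} (P? : ∀ x → Dec (P x)) (w : A → ℚ) xs →
      ∑ˡ (filter P? xs) w ≡ ∑ˡ xs (λ x → ⟦ P? x ⟧ * w x)
    ∑ˡ-filter P? w []       = refl
    ∑ˡ-filter P? w (x ∷ xs) with P? x
    ... | yes _ = cong₂ _+_ (sym (ℚ.*-identityˡ (w x))) (∑ˡ-filter P? w xs)
    ... | no  _ = trans (∑ˡ-filter P? w xs)
      (solve 2 (λ a s → s := con 0ℚ :* a :+ s) refl (w x) (∑ˡ xs (λ x → ⟦ P? x ⟧ * w x)))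

    ∑ˡ-+ : ∀ (w v : A → ℚ) xs → ∑ˡ xs (λ x → w x + v x) ≡ ∑ˡ xs w + ∑ˡ xs v
    ∑ˡ-+ w v []       = refl
    ∑ˡ-+ w v (x ∷ xs) = trans (cong (w x + v x +_) (∑ˡ-+ w v xs))
      (solve 4 (λ a b c d → (a :+ b) :+ (c :+ d) := (a :+ c) :+ (b :+ d)) refl (w x) (v x) (∑ˡ xs w) (∑ˡ xs v))

    ∑ˡ-neg : ∀ (w : A → ℚ) xs → ∑ˡ xs (λ x → - w x) ≡ - ∑ˡ xs w
    ∑ˡ-neg w []       = refl
    ∑ˡ-neg w (x ∷ xs) = trans (cong (- w x +_) (∑ˡ-neg w xs)) (sym (ℚ.neg-distrib-+ (w x) (∑ˡ xs w)))

    ∑ˡ-*ˡ : ∀ c (w : A → ℚ) xs → ∑ˡ xs (λ x → c * w x) ≡ c * ∑ˡ xs w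
    ∑ˡ-*ˡ c w []       = sym (ℚ.*-zeroʳ c)
    ∑ˡ-*ˡ c w (x ∷ xs) = trans (cong (c * w x +_) (∑ˡ-*ˡ c w xs)) (sym (ℚ.*-distribˡ-+ c (w x) (∑ˡ xs w)))

    ∑ˡ-∑< : ∀ n (w : ℕ → A → ℚ) (b : ℕ → ℚ) xs →
      ∑ˡ xs (λ x → ∑< n (λ j → w j x * b j)) ≡ ∑< n (λ j → ∑ˡ xs (w j) * b j)
    ∑ˡ-∑< n w b []       = sym (∑<-zero n (λ j _ → ℚ.*-zeroˡ (b j)))
    ∑ˡ-∑< n w b (x ∷ xs) = begin
      ∑< n (λ j → w j x * b j) + ∑ˡ xs (λ x → ∑< n (λ j → w j x * b j))
        ≡⟨ cong (∑< n (λ j → w j x * b j) +_) (∑ˡ-∑< n w b xs) ⟩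
      ∑< n (λ j → w j x * b j) + ∑< n (λ j → ∑ˡ xs (w j) * b j)
        ≡⟨ ∑<-+ n _ _ ⟨
      ∑< n (λ j → w j x * b j + ∑ˡ xs (w j) * b j)
        ≡⟨ ∑<-cong n (λ j _ → ℚ.*-distribʳ-+ (b j) (w j x) (∑ˡ xs (w j))) ⟨
      ∑< n (λ j → ∑ˡ (x ∷ xs) (w j) * b j) ∎

  -- Power series

  -- Multiplication of the power series Σ g n qⁿ by qᵃ.
  shift : ℕ → (ℕ → ℚ) → ℕ → ℚ
  shift zero    g n       = g n
  shift (suc a) g zero    = 0ℚ
  shift (suc a) g (suc n) = shift a g n

  -- The coefficient of qⁿ in qᵃ g involves g only up to degree n, so identities known up to a
  -- truncation degree can still be multiplied by qᵃ.
  shift-cong-≤ : ∀ a {g h} n → (∀ k → k ≤ n → g k ≡ h k) → shift a g n ≡ shift a h n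
  shift-cong-≤ zero    n       eq = eq n ℕ.≤-refl
  shift-cong-≤ (suc a) zero    eq = refl
  shift-cong-≤ (suc a) (suc n) eq = shift-cong-≤ a n (λ k k≤n → eq k (ℕ.m≤n⇒m≤1+n k≤n))

  shift-cong : ∀ a {g h} → g ≗ h → shift a g ≗ shift a h
  shift-cong a eq n = shift-cong-≤ a n (λ k _ → eq k)

  shift-shift : ∀ a b g → shift a (shift b g) ≗ shift (a ℕ.+ b) g
  shift-shift zero    b g n       = refl
  shift-shift (suc a) b g zero    = refl
  shift-shift (suc a) b g (suc n) = shift-shift a b g n

  shift-comm : ∀ a b g → shift a (shift b g) ≗ shift b (shift a g)
  shift-comm a b g n = begin
    shift a (shift b g) n ≡⟨ shift-shift a b g n ⟩
    shift (a ℕ.+ b) g n   ≡⟨ cong (λ c → shift c g n) (ℕ.+-comm a b) ⟩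
    shift (b ℕ.+ a) g n   ≡⟨ shift-shift b a g n ⟨
    shift b (shift a g) n ∎

  shift-< : ∀ {a n} g → n < a → shift a g n ≡ 0ℚ
  shift-< {suc a} {zero}  g _         = refl
  shift-< {suc a} {suc n} g (s≤s n<a) = shift-< g n<a

  shift-0 : ∀ a → shift a (λ _ → 0ℚ) ≗ λ _ → 0ℚ
  shift-0 zero    n       = refl
  shift-0 (suc a) zero    = refl
  shift-0 (suc a) (suc n) = shift-0 a n

  shift-- : ∀ a g h → shift a (λ n → g n - h n) ≗ λ n → shift a g n - shift a h n
  shift-- zero    g h n       = refl
  shift-- (suc a) g h zero    = refl
  shift-- (suc a) g h (suc n) = shift-- a g h n

  shift-+ : ∀ a g h → shift a (λ n → g n + h n) ≗ λ n → shift a g n + shift a h n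
  shift-+ zero    g h n       = refl
  shift-+ (suc a) g h zero    = refl
  shift-+ (suc a) g h (suc n) = shift-+ a g h n

  shift-*ʳ : ∀ a c g → shift a (λ n → g n * c) ≗ λ n → shift a g n * c
  shift-*ʳ zero    c g n       = refl
  shift-*ʳ (suc a) c g zero    = sym (ℚ.*-zeroˡ c)
  shift-*ʳ (suc a) c g (suc n) = shift-*ʳ a c g n

  shift-≥ : ∀ {a n} g → a ≤ n → shift a g n ≡ g (n ∸ a)
  shift-≥ {zero}  {n}     g _         = refl
  shift-≥ {suc a} {suc n} g (s≤s a≤n) = shift-≥ g a≤n

  shift-*ˡ : ∀ a c g → shift a (λ n → c * g n) ≗ λ n → c * shift a g n
  shift-*ˡ zero    c g n       = refl
  shift-*ˡ (suc a) c g zero    = sym (ℚ.*-zeroʳ c)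
  shift-*ˡ (suc a) c g (suc n) = shift-*ˡ a c g n

  shift-neg : ∀ a g → shift a (λ n → - g n) ≗ λ n → - shift a g n
  shift-neg zero    g n       = refl
  shift-neg (suc a) g zero    = refl
  shift-neg (suc a) g (suc n) = shift-neg a g n

  shift-∑< : ∀ a m (g : ℕ → ℕ → ℚ) → shift a (λ n → ∑< m (λ j → g j n)) ≗ λ n → ∑< m (λ j → shift a (g j) n)
  shift-∑< a zero    g n = shift-0 a n
  shift-∑< a (suc m) g n = trans (shift-+ a _ (g m) n) (cong (_+ shift a (g m) n) (shift-∑< a m g n))

  -- Each coefficient of g is zero or an earlier coefficient, so strong induction applies. This
  -- injectivity of multiplication by 1 - q^{a+1} takes the place of division by that series.
  shift-fixed : ∀ a g → g ≗ shift (suc a) g → g ≗ λ _ → 0ℚ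
  shift-fixed a g eq = <-rec (λ n → g n ≡ 0ℚ) λ
    { zero    rec → eq 0
    ; (suc n) rec → trans (eq (suc n)) (trans (shift-cong-≤ a n (λ k k≤n → rec (s≤s k≤n))) (shift-0 a n))
    }

  δ : ℕ → ℚ
  δ zero    = 1ℚ
  δ (suc _) = 0ℚ

  sgn : ℕ → ℚ
  sgn zero    = 1ℚ
  sgn (suc j) = - sgn j

  -- Sums over partitions

  -- The total bounds the number of parts, so `psum` can use the total as its length bound, even
  -- after a part has been removed.
  boundedPartitions-stable : ∀ {l l′} m n → n ≤ l → n ≤ l′ → boundedPartitions l m n ≡ boundedPartitions l′ m n
  boundedPartitions-stable m zero    _ _ = refl
  boundedPartitions-stable m (suc n) (s≤s n≤l) (s≤s n≤l′) = List.concatMap-cong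
    (λ a → cong (map (suc a ∷_)) (boundedPartitions-stable (suc a) (n ∸ a)
      (ℕ.≤-trans (ℕ.m∸n≤m n a) n≤l) (ℕ.≤-trans (ℕ.m∸n≤m n a) n≤l′)))
    (upTo (m ⊓ suc n))

  -- The coefficient of qⁿ in the generating function of the partitions with parts at most M,
  -- weighted by w.
  psum : ℕ → (List ℕ → ℚ) → ℕ → ℚ
  psum M w n = ∑ˡ (boundedPartitions n M n) w

  psum-cong : ∀ M n {w v} → (∀ {π} → IsPartition n π → All (_≤ M) π → w π ≡ v π) → psum M w n ≡ psum M v n
  psum-cong M n h = ∑ˡ-cong (boundedPartitions n M n)
    (λ π∈ → let isP , ≤M = bounded-sound n M n π∈ in h isP ≤M)

  psum-head : ∀ M w n → psum M w (suc n) ≡ ∑< (M ⊓ suc n) (λ a → psum (suc a) (w ∘ (suc a ∷_)) (n ∸ a))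
  psum-head M w n = begin
    ∑ˡ (boundedPartitions (suc n) M (suc n)) w
      ≡⟨ ∑ˡ-concatMap w _ (upTo (M ⊓ suc n)) ⟩
    ∑ˡ (upTo (M ⊓ suc n)) (λ a → ∑ˡ (map (suc a ∷_) (boundedPartitions n (suc a) (n ∸ a))) w)
      ≡⟨ ∑ˡ-applyUpTo _ (λ a → a) (M ⊓ suc n) ⟩
    ∑< (M ⊓ suc n) (λ a → ∑ˡ (map (suc a ∷_) (boundedPartitions n (suc a) (n ∸ a))) w)
      ≡⟨ ∑<-cong (M ⊓ suc n) (λ a _ → trans
           (∑ˡ-map w (suc a ∷_) (boundedPartitions n (suc a) (n ∸ a)))
           (cong (λ xs → ∑ˡ xs (w ∘ (suc a ∷_))) (boundedPartitions-stable (suc a) (n ∸ a) (ℕ.m∸n≤m n a) ℕ.≤-refl))) ⟩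
    ∑< (M ⊓ suc n) (λ a → psum (suc a) (w ∘ (suc a ∷_)) (n ∸ a)) ∎

  -- Either no part equals M + 1, or M + 1 is the largest part and one copy of it can be removed;
  -- further copies may remain, so the bound on the rest stays M + 1.
  psum-suc : ∀ M w n → psum (suc M) w n ≡ psum M w n + shift (suc M) (psum (suc M) (w ∘ (suc M ∷_))) n
  psum-suc M w zero    = sym (ℚ.+-identityʳ (w [] + 0ℚ))
  psum-suc M w (suc n) with ℕ.≤-<-connex M n
  ... | inj₁ M≤n = begin
    psum (suc M) w (suc n) ≡⟨ psum-head (suc M) w n ⟩
    ∑< (suc (M ⊓ n)) h     ≡⟨ cong (λ m → ∑< (suc m) h) (ℕ.m≤n⇒m⊓n≡m M≤n) ⟩
    ∑< M h + h M
      ≡⟨ cong₂ _+_ (trans (cong (λ m → ∑< m h) (sym (ℕ.m≤n⇒m⊓n≡m (ℕ.m≤n⇒m≤1+n M≤n)))) (sym (psum-head M w n)))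
                   (sym (shift-≥ _ M≤n)) ⟩
    psum M w (suc n) + shift M (psum (suc M) (w ∘ (suc M ∷_))) n ∎
    where h = λ a → psum (suc a) (w ∘ (suc a ∷_)) (n ∸ a)
  ... | inj₂ n<M = begin
    psum (suc M) w (suc n)   ≡⟨ psum-head (suc M) w n ⟩
    ∑< (suc (M ⊓ n)) h       ≡⟨ cong (λ m → ∑< m h) (trans (cong suc (ℕ.m≥n⇒m⊓n≡n (ℕ.<⇒≤ n<M))) (sym (ℕ.m≥n⇒m⊓n≡n n<M))) ⟩
    ∑< (M ⊓ suc n) h         ≡⟨ psum-head M w n ⟨
    psum M w (suc n)         ≡⟨ ℚ.+-identityʳ (psum M w (suc n)) ⟨
    psum M w (suc n) + 0ℚ    ≡⟨ cong (psum M w (suc n) +_) (shift-< _ n<M) ⟨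
    psum M w (suc n) + shift M (psum (suc M) (w ∘ (suc M ∷_))) n ∎
    where h = λ a → psum (suc a) (w ∘ (suc a ∷_)) (n ∸ a)

  psum-0 : ∀ w n → psum 0 w n ≡ δ n * w []
  psum-0 w zero    = trans (ℚ.+-identityʳ (w [])) (sym (ℚ.*-identityˡ (w [])))
  psum-0 w (suc n) = sym (ℚ.*-zeroˡ (w []))

  -- Iterating `psum-suc` sorts the partitions by largest part a + 1; the empty partition, which has
  -- none, is excluded by n ≠ 0.
  psum-largest : ∀ M w n .{{_ : NonZero n}} →
    psum M w n ≡ ∑< M (λ a → shift (suc a) (psum (suc a) (w ∘ (suc a ∷_))) n)
  psum-largest zero    w (suc n) = refl
  psum-largest (suc M) w n = begin
    psum (suc M) w n   ≡⟨ psum-suc M w n ⟩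
    psum M w n + h M   ≡⟨ cong (_+ h M) (psum-largest M w n) ⟩
    ∑< (suc M) h ∎
    where h = λ a → shift (suc a) (psum (suc a) (w ∘ (suc a ∷_))) n

  -- Counting part sizes

  ν-new : ∀ {x ρ} → All (_< x) ρ → ν (x ∷ ρ) ≡ suc (ν ρ)
  ν-new {x} {ρ} <x = cong (suc ∘ length) (List.filter-all (¬? ∘ (x ℕ.≟_))
    (All.map (λ { x<x refl → ℕ.<-irrefl refl x<x }) (All.deduplicate⁺ ℕ._≟_ <x)))

  ν-repeat : ∀ x ρ → ν (x ∷ x ∷ ρ) ≡ ν (x ∷ ρ)
  ν-repeat x ρ = cong (suc ∘ length) (trans
    (List.filter-reject (¬? ∘ (x ℕ.≟_)) (λ x≢x → x≢x refl))
    (List.filter-idem (¬? ∘ (x ℕ.≟_)) (deduplicate ℕ._≟_ ρ)))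

  length≤total : ∀ {n π} → IsPartition n π → length π ≤ n
  length≤total isP = subst (_ ≤_) (IsPartition.total isP) (length≤sum (IsPartition.positive isP))

  ν≤total : ∀ {n π} → IsPartition n π → ν π ≤ n
  ν≤total {π = π} isP = ℕ.≤-trans (List.length-deduplicate ℕ._≟_ π) (length≤total isP)

  -- The q-binomial recursion

  -- The coefficients of xʲ in ∏_{i ≤ M} (1 - x qⁱ)/(1 - qⁱ) and in its
  -- quotient by 1 - q^{M+1}.
  T X : ℕ → ℕ → ℕ → ℚ
  T M j n = sgn j * psum M (λ π → ι (ν π C j)) n
  X M j n = sgn j * psum (suc M) (λ ρ → ι ((ν (suc M ∷ ρ) ∸ 1) C j)) n

  -- Multiplication by x, where the index j is the exponent of x.
  prev : (ℕ → ℕ → ℚ) → ℕ → ℕ → ℚ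
  prev Y zero    n = 0ℚ
  prev Y (suc j) n = Y j n

  -- If M + 1 is absent from ρ, the weight is the one in `T`; if it is present, removing a copy
  -- leaves the weight unchanged. As series, (1 - q^{M+1}) X = T.
  X-rec : ∀ M j n → X M j n ≡ T M j n + shift (suc M) (X M j) n
  X-rec M j n = begin
    sgn j * psum (suc M) w n
      ≡⟨ cong (sgn j *_) (psum-suc M w n) ⟩
    sgn j * (psum M w n + shift (suc M) (psum (suc M) (w ∘ (suc M ∷_))) n)
      ≡⟨ cong (sgn j *_) (cong₂ _+_
           (psum-cong M n (λ _ ≤M → cong (λ v → ι ((v ∸ 1) C j)) (ν-new (All.map s≤s ≤M))))
           (shift-cong (suc M) (λ k → psum-cong (suc M) k (λ {π} _ _ → cong (λ v → ι ((v ∸ 1) C j)) (ν-repeat (suc M) π))) n)) ⟩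
    sgn j * (psum M (λ π → ι (ν π C j)) n + shift (suc M) (psum (suc M) w) n)
      ≡⟨ ℚ.*-distribˡ-+ (sgn j) _ _ ⟩
    T M j n + sgn j * shift (suc M) (psum (suc M) w) n
      ≡⟨ cong (T M j n +_) (shift-*ˡ (suc M) (sgn j) (psum (suc M) w) n) ⟨
    T M j n + shift (suc M) (X M j) n ∎
    where w = λ ρ → ι ((ν (suc M ∷ ρ) ∸ 1) C j)

  nC0≡1 : ∀ n → n C 0 ≡ 1
  nC0≡1 n = trans (nCk≡nC[n∸k] (z≤n {n})) (nCn≡1 n)

  -- Raising M by one multiplies the product by (1 - x q^{M+1})/(1 - q^{M+1}), and `X M` already
  -- carries the denominator. On partitions this is Pascal's rule for those that contain M + 1.
  T-suc : ∀ M j n → T (suc M) j n ≡ X M j n - shift (suc M) (prev (X M) j) n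
  T-suc M zero n = begin
    1ℚ * psum (suc M) (λ π → ι (ν π C 0)) n
      ≡⟨ cong (1ℚ *_) (psum-cong (suc M) n (λ {π} _ _ → cong ι (trans (nC0≡1 (ν π)) (sym (nC0≡1 (ν (suc M ∷ π) ∸ 1)))))) ⟩
    X M 0 n
      ≡⟨ ℚ.+-identityʳ (X M 0 n) ⟨
    X M 0 n - 0ℚ
      ≡⟨ cong (λ z → X M 0 n - z) (shift-0 (suc M) n) ⟨
    X M 0 n - shift (suc M) (λ _ → 0ℚ) n ∎
  T-suc M (suc i) n = begin
    s * psum (suc M) c n
      ≡⟨ cong (s *_) (psum-suc M c n) ⟩
    s * (psum M c n + shift (suc M) (psum (suc M) (c ∘ (suc M ∷_))) n)
      ≡⟨ cong (λ z → s * (psum M c n + z)) (shift-cong (suc M) pascal n) ⟩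
    s * (psum M c n + shift (suc M) (λ k → psum (suc M) (u i) k + psum (suc M) (u (suc i)) k) n)
      ≡⟨ cong (λ z → s * (psum M c n + z)) (shift-+ (suc M) _ _ n) ⟩
    s * (psum M c n + (shift (suc M) (psum (suc M) (u i)) n + shift (suc M) (psum (suc M) (u (suc i))) n))
      ≡⟨ solve 4 (λ t a b c → (:- t) :* (a :+ (b :+ c)) := ((:- t) :* a :+ (:- t) :* c) :- t :* b) refl (sgn i) _ _ _ ⟩
    (T M (suc i) n + s * shift (suc M) (psum (suc M) (u (suc i))) n) - sgn i * shift (suc M) (psum (suc M) (u i)) n
      ≡⟨ cong₂ (λ a b → (T M (suc i) n + a) - b) (shift-*ˡ (suc M) s _ n) (shift-*ˡ (suc M) (sgn i) _ n) ⟨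
    (T M (suc i) n + shift (suc M) (X M (suc i)) n) - shift (suc M) (X M i) n
      ≡⟨ cong (_- shift (suc M) (X M i) n) (X-rec M (suc i) n) ⟨
    X M (suc i) n - shift (suc M) (X M i) n ∎
    where
    s = sgn (suc i)
    c = λ π → ι (ν π C suc i)
    u = λ j ρ → ι ((ν (suc M ∷ ρ) ∸ 1) C j)
    pascal : psum (suc M) (c ∘ (suc M ∷_)) ≗ λ k → psum (suc M) (u i) k + psum (suc M) (u (suc i)) k
    pascal k = trans
      (psum-cong (suc M) k (λ {π} _ _ → trans
        (cong ι (sym (nCk+nC[k+1]≡[n+1]C[k+1] (ν (suc M ∷ π) ∸ 1) i)))
        (ι-+ ((ν (suc M ∷ π) ∸ 1) C i) _)))
      (∑ˡ-+ (u i) (u (suc i)) (boundedPartitions k (suc M) k))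

  -- A partition of n has at most n part sizes, so the binomials vanish. This disposes of the tail
  -- of the diagonal sum.
  T-below : ∀ M {j n} → n < j → T M j n ≡ 0ℚ
  T-below M {j} {n} n<j = begin
    sgn j * psum M (λ π → ι (ν π C j)) n
      ≡⟨ cong (sgn j *_) (psum-cong M n (λ {π} isP _ → cong ι (k>n⇒nCk≡0 (ℕ.≤-<-trans (ν≤total isP) n<j)))) ⟩
    sgn j * psum M (λ _ → 0ℚ) n
      ≡⟨ cong (sgn j *_) (∑ˡ-zero (boundedPartitions n M n)) ⟩
    sgn j * 0ℚ
      ≡⟨ ℚ.*-zeroʳ (sgn j) ⟩
    0ℚ ∎

  -- (1 - qʲ) Y(j) = (q^{M+1} - qʲ) Y(j-1); this determines T M and X M as q-binomial coefficients up to
  -- a factor.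
  QBinomial : ℕ → (ℕ → ℕ → ℚ) → Set
  QBinomial M Y = ∀ j n → Y j n - shift j (Y j) n ≡ shift (suc M) (prev Y j) n - shift j (prev Y j) n

  qbinomial-at-0 : ∀ M (g : ℕ → ℚ) n → g n - g n ≡ shift (suc M) (λ _ → 0ℚ) n - 0ℚ
  qbinomial-at-0 M g n = trans (ℚ.+-inverseʳ (g n)) (cong (_- 0ℚ) (sym (shift-0 (suc M) n)))

  -- The recursion is linear and T = (1 - q^{M+1}) X, so the difference `D` of its two sides for X
  -- satisfies D = q^{M+1} D.
  qbinomial-T⇒X : ∀ M → QBinomial M (T M) → QBinomial M (X M)
  qbinomial-T⇒X M hT j n = difference-zero (shift-fixed M D D-fixed n)
    where
    S J : (ℕ → ℚ) → ℕ → ℚ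
    S = shift (suc M)
    J = shift j
    x t x⁻ t⁻ D : ℕ → ℚ
    x = X M j
    t = T M j
    x⁻ = prev (X M) j
    t⁻ = prev (T M) j
    D k = (x k - J x k) - (S x⁻ k - J x⁻ k)
    prev-rec : ∀ j k → prev (X M) j k ≡ prev (T M) j k + S (prev (X M) j) k
    prev-rec zero    k = sym (trans (ℚ.+-identityˡ _) (shift-0 (suc M) k))
    prev-rec (suc i) k = X-rec M i k
    difference-zero : ∀ {p q} → p - q ≡ 0ℚ → p ≡ q
    difference-zero {p} {q} h = trans (solve 2 (λ p q → p := (p :- q) :+ q) refl p q)
      (trans (cong (_+ q) h) (ℚ.+-identityˡ q))
    D-fixed : D ≗ S D
    D-fixed k = begin
      (x k - J x k) - (S x⁻ k - J x⁻ k)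
        ≡⟨ cong₂ _-_
             (cong₂ _-_ (X-rec M j k) (trans (shift-cong j (X-rec M j) k) (shift-+ j _ _ k)))
             (cong₂ _-_ (trans (shift-cong (suc M) (prev-rec j) k) (shift-+ (suc M) _ _ k))
                        (trans (shift-cong j (prev-rec j) k) (shift-+ j _ _ k))) ⟩
      ((t k + S x k) - (J t k + J (S x) k)) - ((S t⁻ k + S (S x⁻) k) - (J t⁻ k + J (S x⁻) k))
        ≡⟨ solve 8 (λ t Sx Jt JSx St SSx Jt⁻ JSx⁻ →
             ((t :+ Sx) :- (Jt :+ JSx)) :- ((St :+ SSx) :- (Jt⁻ :+ JSx⁻))
             := ((t :- Jt) :- (St :- Jt⁻)) :+ ((Sx :- JSx) :- (SSx :- JSx⁻))) refl
             (t k) (S x k) (J t k) (J (S x) k) (S t⁻ k) (S (S x⁻) k) (J t⁻ k) (J (S x⁻) k) ⟩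
      ((t k - J t k) - (S t⁻ k - J t⁻ k)) + ((S x k - J (S x) k) - (S (S x⁻) k - J (S x⁻) k))
        -- The part built from T vanishes by hypothesis; in the rest q^{M+1} is moved outermost.
        ≡⟨ cong₂ _+_ (trans (cong (_- (S t⁻ k - J t⁻ k)) (hT j k)) (ℚ.+-inverseʳ (S t⁻ k - J t⁻ k)))
             (cong₂ (λ a b → (S x k - a) - (S (S x⁻) k - b)) (shift-comm j (suc M) x k) (shift-comm j (suc M) x⁻ k)) ⟩
      0ℚ + ((S x k - S (J x) k) - (S (S x⁻) k - S (J x⁻) k))
        ≡⟨ ℚ.+-identityˡ _ ⟩
      (S x k - S (J x) k) - (S (S x⁻) k - S (J x⁻) k)
        ≡⟨ cong₂ _-_ (shift-- (suc M) _ _ k) (shift-- (suc M) _ _ k) ⟨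
      S (λ k → x k - J x k) k - S (λ k → S x⁻ k - J x⁻ k) k
        ≡⟨ shift-- (suc M) _ _ k ⟨
      S D k ∎

  -- With T (M + 1) = (1 - x q^{M+1}) X M, the claim at j = i + 1 combines the recursion for X at i
  -- + 1 with q^{M+2} times the recursion at i.
  qbinomial-X⇒T : ∀ M → QBinomial M (X M) → QBinomial (suc M) (T (suc M))
  qbinomial-X⇒T M hX zero    n = qbinomial-at-0 (suc M) (T (suc M) 0) n
  qbinomial-X⇒T M hX (suc i) n = begin
    T (suc M) (suc i) n - J (T (suc M) (suc i)) n
      ≡⟨ cong₂ _-_ (T-suc M (suc i) n) (trans (shift-cong (suc i) (T-suc M (suc i)) n) (shift-- (suc i) _ _ n)) ⟩
    (X M (suc i) n - S x n) - (J (X M (suc i)) n - J (S x) n)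
      ≡⟨ solve 4 (λ a b c d → (a :- b) :- (c :- d) := ((a :- c) :- b) :+ d) refl
           (X M (suc i) n) (S x n) (J (X M (suc i)) n) (J (S x) n) ⟩
    ((X M (suc i) n - J (X M (suc i)) n) - S x n) + J (S x) n
      ≡⟨ cong₂ (λ a b → (a - S x n) + b) (hX (suc i) n) (trans (exchange x) shifted) ⟩
    ((S x n - J x n) - S x n) + ((S′ x n - S′ (S x⁻) n) + J (S x⁻) n)
      ≡⟨ solve 5 (λ s j p r u → ((s :- j) :- s) :+ ((p :- r) :+ u) := (p :- r) :- (j :- u)) refl
           (S x n) (J x n) (S′ x n) (S′ (S x⁻) n) (J (S x⁻) n) ⟩
    (S′ x n - S′ (S x⁻) n) - (J x n - J (S x⁻) n)
      ≡⟨ cong₂ _-_ (expand (suc (suc M))) (expand (suc i)) ⟨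
    S′ (T (suc M) i) n - J (T (suc M) i) n ∎
    where
    S S′ I J : (ℕ → ℚ) → ℕ → ℚ
    S = shift (suc M)
    S′ = shift (suc (suc M))
    I = shift i
    J = shift (suc i)
    x x⁻ : ℕ → ℚ
    x = X M i
    x⁻ = prev (X M) i
    -- q^{i+1} q^{M+1} = q^{M+2} qⁱ, which produces the factor qⁱ that the recursion at i can
    -- rewrite.
    exchange : ∀ g → J (S g) n ≡ S′ (I g) n
    exchange g = begin
      J (S g) n                      ≡⟨ shift-shift (suc i) (suc M) g n ⟩
      shift (suc i ℕ.+ suc M) g n    ≡⟨ cong (λ a → shift a g n) (cong suc (trans (ℕ.+-suc i M) (cong suc (ℕ.+-comm i M)))) ⟩
      shift (suc (suc M) ℕ.+ i) g n  ≡⟨ shift-shift (suc (suc M)) i g n ⟨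
      S′ (I g) n ∎
    expand : ∀ a → shift a (T (suc M) i) n ≡ shift a x n - shift a (S x⁻) n
    expand a = trans (shift-cong a (T-suc M i) n) (shift-- a _ _ n)
    shifted : S′ (I x) n ≡ (S′ x n - S′ (S x⁻) n) + J (S x⁻) n
    shifted = begin
      S′ (I x) n
        ≡⟨ solve 2 (λ p a → a := p :- (p :- a)) refl (S′ x n) (S′ (I x) n) ⟩
      S′ x n - (S′ x n - S′ (I x) n)
        ≡⟨ cong (λ z → S′ x n - z)
             (trans (sym (shift-- (suc (suc M)) _ _ n)) (trans (shift-cong (suc (suc M)) (hX i) n) (shift-- (suc (suc M)) _ _ n))) ⟩
      S′ x n - (S′ (S x⁻) n - S′ (I x⁻) n)
        ≡⟨ cong (λ z → S′ x n - (S′ (S x⁻) n - z)) (exchange x⁻) ⟨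
      S′ x n - (S′ (S x⁻) n - J (S x⁻) n)
        ≡⟨ solve 3 (λ p a b → p :- (a :- b) := (p :- a) :+ b) refl (S′ x n) (S′ (S x⁻) n) (J (S x⁻) n) ⟩
      (S′ x n - S′ (S x⁻) n) + J (S x⁻) n ∎

  T-0-0 : T 0 0 ≗ δ
  T-0-0 n = trans (cong (1ℚ *_) (psum-0 (λ π → ι (ν π C 0)) n))
    (solve 1 (λ d → con 1ℚ :* (d :* con 1ℚ) := d) refl (δ n))

  T-0-suc : ∀ i → T 0 (suc i) ≗ λ _ → 0ℚ
  T-0-suc i n = trans (cong (sgn (suc i) *_) (psum-0 (λ π → ι (ν π C suc i)) n))
    (solve 2 (λ s d → s :* (d :* con 0ℚ) := con 0ℚ) refl (sgn (suc i)) (δ n))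

  qbinomial-T-0 : QBinomial 0 (T 0)
  qbinomial-T-0 zero    n = qbinomial-at-0 0 (T 0 0) n
  qbinomial-T-0 (suc i) n = begin
    T 0 (suc i) n - shift (suc i) (T 0 (suc i)) n
      ≡⟨ cong₂ _-_ (T-0-suc i n) (trans (shift-cong (suc i) (T-0-suc i) n) (shift-0 (suc i) n)) ⟩
    0ℚ ≡⟨ right i ⟩
    shift 1 (T 0 i) n - shift (suc i) (T 0 i) n ∎
    where
    right : ∀ i → 0ℚ ≡ shift 1 (T 0 i) n - shift (suc i) (T 0 i) n
    right zero    = sym (ℚ.+-inverseʳ (shift 1 (T 0 0) n))
    right (suc i) = sym (cong₂ _-_
      (trans (shift-cong 1 (T-0-suc i) n) (shift-0 1 n))
      (trans (shift-cong (suc (suc i)) (T-0-suc i) n) (shift-0 (suc (suc i)) n)))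

  -- Induction on M, alternately dividing by 1 - q^{M+1} and multiplying by 1 - x q^{M+1}.
  qbinomial-T : ∀ M → QBinomial M (T M)
  qbinomial-X : ∀ M → QBinomial M (X M)
  qbinomial-T zero    = qbinomial-T-0
  qbinomial-T (suc M) = qbinomial-X⇒T M (qbinomial-X M)
  qbinomial-X M = qbinomial-T⇒X M (qbinomial-T M)

  -- The product has degree M in x. In the recursion, the factor q^{M+1} - qʲ is zero at j = M + 1,
  -- and for larger j the preceding coefficient is already zero; then (1 - qʲ) X M j = 0 forces X M
  -- j = 0.
  X-above : ∀ {M j} → M < j → X M j ≗ λ _ → 0ℚ
  X-above {M} {i} M<j = subst (λ j → X M j ≗ λ _ → 0ℚ)
    (trans (sym (ℕ.+-suc (i ∸ suc M) M)) (ℕ.m∸n+n≡m M<j)) (above (i ∸ suc M))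
    where
    above : ∀ d → X M (suc (d ℕ.+ M)) ≗ λ _ → 0ℚ
    difference : ∀ d n → shift (suc M) (X M (d ℕ.+ M)) n - shift (suc (d ℕ.+ M)) (X M (d ℕ.+ M)) n ≡ 0ℚ
    above d = shift-fixed (d ℕ.+ M) (X M j) λ n → begin
      X M j n                                     ≡⟨ solve 2 (λ a b → a := (a :- b) :+ b) refl (X M j n) (shift j (X M j) n) ⟩
      (X M j n - shift j (X M j) n) + shift j (X M j) n
        ≡⟨ cong (_+ shift j (X M j) n) (trans (qbinomial-X M j n) (difference d n)) ⟩
      0ℚ + shift j (X M j) n                      ≡⟨ ℚ.+-identityˡ _ ⟩
      shift j (X M j) n ∎
      where j = suc (d ℕ.+ M)
    difference zero    n = ℚ.+-inverseʳ (shift (suc M) (X M M) n)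
    difference (suc d) n = cong₂ _-_
      (trans (shift-cong (suc M) (above d) n) (shift-0 (suc M) n))
      (trans (shift-cong (suc (suc (d ℕ.+ M))) (above d) n) (shift-0 (suc (suc (d ℕ.+ M))) n))

  -- The telescoping diagonal sum

  -- The term q^{M+1} X M j enters through `T-suc` and `X-rec` with opposite signs and cancels.
  -- Summed along a diagonal, what remains telescopes.
  T-X-step : ∀ M j n → T (suc M) (suc j) n + X M j n ≡ X M (suc j) n + T M j n
  T-X-step M j n = begin
    T (suc M) (suc j) n + X M j n
      ≡⟨ cong₂ _+_ (T-suc M (suc j) n) (X-rec M j n) ⟩
    (X M (suc j) n - shift (suc M) (X M j) n) + (T M j n + shift (suc M) (X M j) n)
      ≡⟨ solve 3 (λ a b c → (a :- b) :+ (c :+ b) := a :+ c) refl (X M (suc j) n) (shift (suc M) (X M j) n) (T M j n) ⟩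
    X M (suc j) n + T M j n ∎

  -- The diagonal sum Σ_j X (M + j) j telescopes: the terms telescope to T M 0 for M = 0, and
  -- increasing M changes nothing except for a tail of high order.
  diagonal-sum : ∀ M J n → n ≤ J → T (M ℕ.+ J) J n + ∑< J (λ j → X (M ℕ.+ j) j n) ≡ δ n
  diagonal-sum zero J n _ = go J
    where
    go : ∀ J → T J J n + ∑< J (λ j → X j j n) ≡ δ n
    go zero    = trans (ℚ.+-identityʳ (T 0 0 n)) (T-0-0 n)
    go (suc J) = begin
      T (suc J) (suc J) n + (∑< J (λ j → X j j n) + X J J n)
        ≡⟨ solve 3 (λ a b c → a :+ (b :+ c) := (a :+ c) :+ b) refl (T (suc J) (suc J) n) (∑< J (λ j → X j j n)) (X J J n) ⟩
      (T (suc J) (suc J) n + X J J n) + ∑< J (λ j → X j j n)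
        -- `X J` has degree J in x, so its coefficient at J + 1 drops out.
        ≡⟨ cong (_+ ∑< J (λ j → X j j n)) (trans (T-X-step J J n)
             (trans (cong (_+ T J J n) (X-above (ℕ.n<1+n J) n)) (ℚ.+-identityˡ (T J J n)))) ⟩
      T J J n + ∑< J (λ j → X j j n)
        ≡⟨ go J ⟩
      δ n ∎
  diagonal-sum (suc M) J n n≤J = begin
    T (suc M ℕ.+ J) J n + ∑< J (λ j → X (suc M ℕ.+ j) j n)
      ≡⟨ telescope J ⟩
    ∑< (suc J) (λ j → X (M ℕ.+ j) j n)
      ≡⟨ ℚ.+-identityˡ _ ⟨
    0ℚ + ∑< (suc J) (λ j → X (M ℕ.+ j) j n)
      ≡⟨ cong (_+ ∑< (suc J) (λ j → X (M ℕ.+ j) j n)) (T-below (M ℕ.+ suc J) (s≤s n≤J)) ⟨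
    T (M ℕ.+ suc J) (suc J) n + ∑< (suc J) (λ j → X (M ℕ.+ j) j n)
      ≡⟨ diagonal-sum M (suc J) n (ℕ.m≤n⇒m≤1+n n≤J) ⟩
    δ n ∎
    where
    telescope : ∀ J → T (suc M ℕ.+ J) J n + ∑< J (λ j → X (suc M ℕ.+ j) j n) ≡ ∑< (suc J) (λ j → X (M ℕ.+ j) j n)
    telescope zero = begin
      T (suc (M ℕ.+ 0)) 0 n + 0ℚ
        ≡⟨ cong (_+ 0ℚ) (trans (T-suc (M ℕ.+ 0) 0 n) (cong (λ z → X (M ℕ.+ 0) 0 n - z) (shift-0 (suc (M ℕ.+ 0)) n))) ⟩
      (X (M ℕ.+ 0) 0 n - 0ℚ) + 0ℚ
        ≡⟨ solve 1 (λ a → (a :- con 0ℚ) :+ con 0ℚ := con 0ℚ :+ a) refl (X (M ℕ.+ 0) 0 n) ⟩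
      0ℚ + X (M ℕ.+ 0) 0 n ∎
    telescope (suc J) = begin
      T (suc (M ℕ.+ suc J)) (suc J) n + (s + X (suc M ℕ.+ J) J n)
        ≡⟨ cong (λ m → T (suc m) (suc J) n + (s + X (suc M ℕ.+ J) J n)) (ℕ.+-suc M J) ⟩
      T (suc m) (suc J) n + (s + X m J n)
        ≡⟨ solve 3 (λ a b c → a :+ (b :+ c) := (a :+ c) :+ b) refl (T (suc m) (suc J) n) s (X m J n) ⟩
      (T (suc m) (suc J) n + X m J n) + s
        ≡⟨ cong (_+ s) (T-X-step m J n) ⟩
      (X m (suc J) n + T m J n) + s
        ≡⟨ solve 3 (λ a b c → (a :+ b) :+ c := (b :+ c) :+ a) refl (X m (suc J) n) (T m J n) s ⟩
      (T m J n + s) + X m (suc J) n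
        ≡⟨ cong₂ _+_ (telescope J) (cong (λ m → X m (suc J) n) (sym (ℕ.+-suc M J))) ⟩
      ∑< (suc J) (λ j → X (M ℕ.+ j) j n) + X (M ℕ.+ suc J) (suc J) n ∎
      where
      m = suc (M ℕ.+ J)
      s = ∑< J (λ j → X (suc M ℕ.+ j) j n)

  -- Recursion in m on the partition side

  -- The coefficient of f (1 + m) qⁿ on the partition side; terms with j ≥ n vanish.
  R : ℕ → ℕ → ℕ → ℚ
  R J m n = ∑< J (λ j → shift (suc (m ℕ.+ j)) (X (m ℕ.+ j) j) n)

  R-above : ∀ J {m n} → n ≤ m → R J m n ≡ 0ℚ
  R-above J {m} n≤m = ∑<-zero J (λ j _ → shift-< (X (m ℕ.+ j) j) (s≤s (ℕ.≤-trans n≤m (ℕ.m≤m+n m j))))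

  -- The q-binomial recursion trades the factor q^{M+1} of `T-suc` for qʲ. For M = m + j, a further
  -- factor q^{m+1} gives exactly the exponent m + j + 1 used in `R`.
  T-qbinomial : ∀ M j n → T (suc M) j n ≡ shift j (X M j) n - shift j (prev (X M) j) n
  T-qbinomial M j n = begin
    T (suc M) j n                                  ≡⟨ T-suc M j n ⟩
    X M j n - s                                    ≡⟨ solve 3 (λ x s a → x :- s := a :+ ((x :- a) :- s)) refl (X M j n) s a ⟩
    a + ((X M j n - a) - s)                        ≡⟨ cong (λ z → a + (z - s)) (qbinomial-X M j n) ⟩
    a + ((s - b) - s)                              ≡⟨ solve 3 (λ a s b → a :+ ((s :- b) :- s) := a :- b) refl a s b ⟩
    a - b ∎
    where
    s = shift (suc M) (prev (X M) j) n
    a = shift j (X M j) n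
    b = shift j (prev (X M) j) n

  -- After the index shift j ↦ j + 1, the terms of `R J (suc m)` carry the same power of q and the
  -- same series X (m + j) as those of `R (suc J) m`, but at j - 1 in place of j. By `T-qbinomial`
  -- the termwise difference is q^{m+1} T.
  R-difference : ∀ J m n → R (suc J) m n ≡ R J (suc m) n + shift (suc m) (λ k → ∑< (suc J) (λ j → T (suc (m ℕ.+ j)) j k)) n
  R-difference J m n = begin
    ∑< (suc J) a
      ≡⟨ solve 2 (λ a b → a := b :+ (a :- b)) refl (∑< (suc J) a) (∑< (suc J) b) ⟩
    ∑< (suc J) b + (∑< (suc J) a - ∑< (suc J) b)
      ≡⟨ cong₂ _+_ (trans (∑<-head J b) (trans (cong (_+ ∑< J (b ∘ suc)) (shift-0 (suc (m ℕ.+ 0)) n)) (ℚ.+-identityˡ (∑< J (b ∘ suc)))))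
                   (∑<-- a b (suc J)) ⟩
    ∑< J (b ∘ suc) + ∑< (suc J) (λ j → a j - b j)
      ≡⟨ cong₂ _+_ (∑<-cong J (λ j _ → cong (λ l → shift (suc l) (X l j) n) (ℕ.+-suc m j)))
                   (∑<-cong (suc J) (λ j _ → term j)) ⟩
    R J (suc m) n + ∑< (suc J) (λ j → shift (suc m) (T (suc (m ℕ.+ j)) j) n)
      ≡⟨ cong (R J (suc m) n +_) (shift-∑< (suc m) (suc J) (λ j → T (suc (m ℕ.+ j)) j) n) ⟨
    R J (suc m) n + shift (suc m) (λ k → ∑< (suc J) (λ j → T (suc (m ℕ.+ j)) j k)) n ∎
    where
    a b : ℕ → ℚ
    a j = shift (suc (m ℕ.+ j)) (X (m ℕ.+ j) j) n
    b j = shift (suc (m ℕ.+ j)) (prev (X (m ℕ.+ j)) j) n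
    term : ∀ j → a j - b j ≡ shift (suc m) (T (suc (m ℕ.+ j)) j) n
    term j = sym (begin
      shift (suc m) (T (suc (m ℕ.+ j)) j) n
        ≡⟨ trans (shift-cong (suc m) (T-qbinomial (m ℕ.+ j) j) n) (shift-- (suc m) _ _ n) ⟩
      shift (suc m) (shift j (X (m ℕ.+ j) j)) n - shift (suc m) (shift j (prev (X (m ℕ.+ j)) j)) n
        ≡⟨ cong₂ _-_ (shift-shift (suc m) j _ n) (shift-shift (suc m) j _ n) ⟩
      a j - b j ∎)

  -- R m - R (m + 1) is q^{m+1} times a sum of T's. Adding R (m + 1) to that sum turns T into X
  -- through `X-rec`, and the diagonal sum collapses to 1.
  R-rec : ∀ {J} m {n} → n ≤ J → R J m n + shift (suc m) (R J (suc m)) n ≡ R J (suc m) n + shift (suc m) δ n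
  R-rec {J} m {n} n≤J = begin
    R J m n + shift (suc m) r n
      -- The extra term j = J has order m + J + 1 > n and vanishes.
      ≡⟨ cong (_+ shift (suc m) r n) (trans (sym (ℚ.+-identityʳ (R J m n)))
           (cong (R J m n +_) (sym (shift-< (X (m ℕ.+ J) J) (s≤s (ℕ.≤-trans n≤J (ℕ.m≤n+m J m))))))) ⟩
    R (suc J) m n + shift (suc m) r n
      ≡⟨ cong (_+ shift (suc m) r n) (R-difference J m n) ⟩
    (r n + shift (suc m) t n) + shift (suc m) r n
      ≡⟨ ℚ.+-assoc (r n) _ _ ⟩
    r n + (shift (suc m) t n + shift (suc m) r n)
      ≡⟨ cong (r n +_) (shift-+ (suc m) t r n) ⟨
    r n + shift (suc m) (λ k → t k + r k) n
      ≡⟨ cong (r n +_) (shift-cong-≤ (suc m) n (λ k k≤n → t+r k (ℕ.≤-trans k≤n n≤J))) ⟩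
    r n + shift (suc m) δ n ∎
    where
    r t : ℕ → ℚ
    r = R J (suc m)
    t k = ∑< (suc J) (λ j → T (suc (m ℕ.+ j)) j k)
    t+r : ∀ k → k ≤ J → t k + r k ≡ δ k
    t+r k k≤J = begin
      (∑< J (λ j → T (suc m ℕ.+ j) j k) + T (suc m ℕ.+ J) J k) + r k
        ≡⟨ solve 3 (λ a b c → (a :+ b) :+ c := b :+ (a :+ c)) refl (∑< J (λ j → T (suc m ℕ.+ j) j k)) (T (suc m ℕ.+ J) J k) (r k) ⟩
      T (suc m ℕ.+ J) J k + (∑< J (λ j → T (suc m ℕ.+ j) j k) + r k)
        ≡⟨ cong (T (suc m ℕ.+ J) J k +_) (trans (sym (∑<-+ J _ _)) (∑<-cong J (λ j _ → sym (X-rec (suc m ℕ.+ j) j k)))) ⟩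
      T (suc m ℕ.+ J) J k + ∑< J (λ j → X (suc m ℕ.+ j) j k)
        ≡⟨ diagonal-sum (suc m) J k k≤J ⟩
      δ k ∎

  -- Partitions into distinct parts

  distinctWeight : ℕ → List ℕ → ℚ
  distinctWeight t π = ⟦ all? (t <?_) π ⟧ * (⟦ unique? π ⟧ * sgn (length π))

  -- The coefficient of qⁿ in ∏_{t < i ≤ M} (1 - qⁱ).
  D : ℕ → ℕ → ℕ → ℚ
  D t M = psum M (distinctWeight t)

  distinctWeight-repeat : ∀ t x ρ → distinctWeight t (x ∷ x ∷ ρ) ≡ 0ℚ
  distinctWeight-repeat t x ρ = begin
    a * (⟦ unique? (x ∷ x ∷ ρ) ⟧ * s)  ≡⟨ cong (λ u → a * (u * s)) (⟦⟧-false (unique? (x ∷ x ∷ ρ)) (λ { ((x≢x ∷ _) ∷ _) → x≢x refl })) ⟩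
    a * (0ℚ * s)                       ≡⟨ solve 2 (λ a s → a :* (con 0ℚ :* s) := con 0ℚ) refl a s ⟩
    0ℚ ∎
    where
    a = ⟦ all? (t <?_) (x ∷ x ∷ ρ) ⟧
    s = sgn (length (x ∷ x ∷ ρ))

  unique-new : ∀ {x ρ} → All (_< x) ρ → ⟦ unique? (x ∷ ρ) ⟧ ≡ ⟦ unique? ρ ⟧
  unique-new {x} {ρ} <x = ⟦⟧-cong {P? = unique? (x ∷ ρ)} {unique? ρ} (mk⇔
    (λ { (_ ∷ u) → u })
    (λ u → All.map (λ { y<x refl → ℕ.<-irrefl refl y<x }) <x ∷ u))

  distinctWeight-new : ∀ {t x ρ} → t < x → All (_< x) ρ → distinctWeight t (x ∷ ρ) ≡ - distinctWeight t ρ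
  distinctWeight-new {t} {x} {ρ} t<x <x = begin
    ⟦ all? (t <?_) (x ∷ ρ) ⟧ * (⟦ unique? (x ∷ ρ) ⟧ * - s)
      ≡⟨ cong₂ (λ a u → a * (u * - s))
           (⟦⟧-cong {P? = all? (t <?_) (x ∷ ρ)} {all? (t <?_) ρ} (mk⇔ All.tail (t<x ∷_)))
           (unique-new <x) ⟩
    ⟦ all? (t <?_) ρ ⟧ * (⟦ unique? ρ ⟧ * - s)
      ≡⟨ solve 3 (λ a u s → a :* (u :* (:- s)) := :- (a :* (u :* s))) refl ⟦ all? (t <?_) ρ ⟧ ⟦ unique? ρ ⟧ s ⟩
    - distinctWeight t ρ ∎
    where s = sgn (length ρ)

  distinctWeight-small : ∀ {t x ρ} → x ≤ t → distinctWeight t (x ∷ ρ) ≡ 0ℚ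
  distinctWeight-small {t} {x} {ρ} x≤t = begin
    ⟦ all? (t <?_) (x ∷ ρ) ⟧ * s ≡⟨ cong (_* s) (⟦⟧-false (all? (t <?_) (x ∷ ρ)) (λ { (t<x ∷ _) → ℕ.<⇒≱ t<x x≤t })) ⟩
    0ℚ * s                       ≡⟨ ℚ.*-zeroˡ s ⟩
    0ℚ ∎
    where s = ⟦ unique? (x ∷ ρ) ⟧ * sgn (length (x ∷ ρ))

  psum-zero : ∀ M n {w} → (∀ π → w π ≡ 0ℚ) → psum M w n ≡ 0ℚ
  psum-zero M n h = trans (∑ˡ-cong (boundedPartitions n M n) (λ {π} _ → h π)) (∑ˡ-zero (boundedPartitions n M n))

  D-trivial : ∀ {t M} → M ≤ t → D t M ≗ δ
  D-trivial {t} {zero}  _   n = trans (psum-0 (distinctWeight t) n) (ℚ.*-identityʳ (δ n))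
  D-trivial {t} {suc M} M<t n = begin
    D t (suc M) n
      ≡⟨ psum-suc M (distinctWeight t) n ⟩
    D t M n + shift (suc M) (psum (suc M) (distinctWeight t ∘ (suc M ∷_))) n
      ≡⟨ cong₂ _+_ (D-trivial (ℕ.<⇒≤ M<t) n)
           (trans (shift-cong (suc M) (λ k → psum-zero (suc M) k (λ ρ → distinctWeight-small {ρ = ρ} M<t)) n) (shift-0 (suc M) n)) ⟩
    δ n + 0ℚ
      ≡⟨ ℚ.+-identityʳ (δ n) ⟩
    δ n ∎

  -- Distinctness allows at most one copy of M + 1, and using it flips the sign; this is the factor
  -- 1 - q^{M+1}.
  D-largest : ∀ {t M} → t ≤ M → ∀ n → D t (suc M) n ≡ D t M n - shift (suc M) (D t M) n
  D-largest {t} {M} t≤M n = begin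
    D t (suc M) n
      ≡⟨ psum-suc M w n ⟩
    D t M n + shift (suc M) (psum (suc M) (w ∘ (suc M ∷_))) n
      ≡⟨ cong (D t M n +_) (trans (shift-cong (suc M) tails n) (shift-neg (suc M) (D t M) n)) ⟩
    D t M n - shift (suc M) (D t M) n ∎
    where
    w = distinctWeight t
    tails : psum (suc M) (w ∘ (suc M ∷_)) ≗ λ k → - D t M k
    tails k = begin
      psum (suc M) (w ∘ (suc M ∷_)) k
        ≡⟨ psum-suc M (w ∘ (suc M ∷_)) k ⟩
      psum M (w ∘ (suc M ∷_)) k + shift (suc M) (psum (suc M) (λ ρ → w (suc M ∷ suc M ∷ ρ))) k
        ≡⟨ cong₂ _+_
             (psum-cong M k (λ _ ≤M → distinctWeight-new (s≤s t≤M) (All.map s≤s ≤M)))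
             (trans (shift-cong (suc M) (λ k → psum-zero (suc M) k (distinctWeight-repeat t (suc M))) k) (shift-0 (suc M) k)) ⟩
      psum M (λ π → - w π) k + 0ℚ
        ≡⟨ ℚ.+-identityʳ _ ⟩
      psum M (λ π → - w π) k
        ≡⟨ ∑ˡ-neg w (boundedPartitions k M k) ⟩
      - D t M k ∎

  -- Partitions are built from the largest part down, so the lowest factor 1 - q^{t+1} is reached by
  -- induction on M, commuting it past the top factor.
  D-smallest : ∀ {t M} → t < M → ∀ n → D t M n ≡ D (suc t) M n - shift (suc t) (D (suc t) M) n
  D-smallest {t} {suc M} (s≤s t≤M) n with ℕ.m≤n⇒m<n∨m≡n t≤M
  ... | inj₂ refl = begin
    D t (suc t) n                    ≡⟨ D-largest ℕ.≤-refl n ⟩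
    D t t n - shift (suc t) (D t t) n ≡⟨ cong₂ _-_ (same n) (shift-cong (suc t) same n) ⟩
    D (suc t) (suc t) n - shift (suc t) (D (suc t) (suc t)) n ∎
    where
    same : D t t ≗ D (suc t) (suc t)
    same k = trans (D-trivial ℕ.≤-refl k) (sym (D-trivial ℕ.≤-refl k))
  ... | inj₁ t<M = begin
    D t (suc M) n
      ≡⟨ D-largest t≤M n ⟩
    D t M n - S (D t M) n
      ≡⟨ cong₂ _-_ (D-smallest t<M n) (trans (shift-cong (suc M) (D-smallest t<M) n) (shift-- (suc M) d (U d) n)) ⟩
    (d n - U d n) - (S d n - S (U d) n)
      ≡⟨ cong (λ z → (d n - U d n) - (S d n - z)) (shift-comm (suc M) (suc t) d n) ⟩
    (d n - U d n) - (S d n - U (S d) n)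
      ≡⟨ solve 4 (λ a b c e → (a :- b) :- (c :- e) := (a :- c) :- (b :- e)) refl (d n) (U d n) (S d n) (U (S d) n) ⟩
    (d n - S d n) - (U d n - U (S d) n)
      ≡⟨ cong₂ _-_ (D-largest t<M n) (trans (shift-cong (suc t) (D-largest t<M) n) (shift-- (suc t) d (S d) n)) ⟨
    D (suc t) (suc M) n - U (D (suc t) (suc M)) n ∎
    where
    S U : (ℕ → ℚ) → ℕ → ℚ
    S = shift (suc M)
    U = shift (suc t)
    d : ℕ → ℚ
    d = D (suc t) M

  -- Both sides satisfy y m = y (m+1) + q^{m+1} (1 - y (m+1)) and vanish for m = N.
  coefficients-agree : ∀ {J N} → N ≤ J → ∀ d m → m ℕ.+ d ≡ N → ∀ n → n ≤ N → δ n - D m N n ≡ R J m n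
  coefficients-agree {J} {N} N≤J zero m m≡N n n≤N = begin
    δ n - D m N n ≡⟨ cong (λ z → δ n - z) (D-trivial N≤m n) ⟩
    δ n - δ n     ≡⟨ ℚ.+-inverseʳ (δ n) ⟩
    0ℚ            ≡⟨ R-above J (ℕ.≤-trans n≤N N≤m) ⟨
    R J m n ∎
    where
    N≤m : N ≤ m
    N≤m = ℕ.≤-reflexive (trans (sym m≡N) (ℕ.+-identityʳ m))
  coefficients-agree {J} {N} N≤J (suc d) m m+≡N n n≤N = begin
    δ n - D m N n
      ≡⟨ cong (λ z → δ n - z) (D-smallest m<N n) ⟩
    δ n - (e n - S e n)
      ≡⟨ solve 4 (λ a b c s → a :- (b :- c) := ((a :- b) :+ s) :- (s :- c)) refl (δ n) (e n) (S e n) (S δ n) ⟩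
    ((δ n - e n) + S δ n) - (S δ n - S e n)
      ≡⟨ cong₂ (λ a b → (a + S δ n) - b) (ih n n≤N)
           (trans (sym (shift-- (suc m) δ e n)) (shift-cong-≤ (suc m) n (λ k k≤n → ih k (ℕ.≤-trans k≤n n≤N)))) ⟩
    (R J (suc m) n + S δ n) - S (R J (suc m)) n
      ≡⟨ cong (_- S (R J (suc m)) n) (R-rec m (ℕ.≤-trans n≤N N≤J)) ⟨
    (R J m n + S (R J (suc m)) n) - S (R J (suc m)) n
      ≡⟨ solve 2 (λ a b → (a :+ b) :- b := a) refl (R J m n) (S (R J (suc m)) n) ⟩
    R J m n ∎
    where
    S : (ℕ → ℚ) → ℕ → ℚ
    S = shift (suc m)
    e : ℕ → ℚ
    e = D (suc m) N
    m<N : m < N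
    m<N = subst (m <_) m+≡N (ℕ.m<m+n m (s≤s z≤n))
    ih : ∀ k → k ≤ N → δ k - e k ≡ R J (suc m) k
    ih = coefficients-agree N≤J d (suc m) (trans (sym (ℕ.+-suc m d)) m+≡N)

  -- The two sides as linear combinations of f 1, …, f N

  smallest-> : ∀ m x ρ → m < smallest (x ∷ ρ) ⇔ All (m <_) (x ∷ ρ)
  smallest-> m x ρ = mk⇔
    (λ m<s → ℕ.<-≤-trans m<s (Extrema.min≤⊤ x ρ) ∷ All.map (ℕ.<-≤-trans m<s) (Extrema.min≤xs x ρ))
    (λ { (m<x ∷ m<ρ) → Extrema.v<min⁺ m<x m<ρ })

  -- Indicators make the range of summation the same for all partitions, so that the two sums can be
  -- interchanged.
  ∑-smallest : ∀ f {n x ρ} → IsPartition n (x ∷ ρ) →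
    ∑ˡ [1⋯ smallest (x ∷ ρ) ] f ≡ ∑< n (λ m → ⟦ all? (m <?_) (x ∷ ρ) ⟧ * f (suc m))
  ∑-smallest f {n} {x} {ρ} isP = begin
    ∑ˡ [1⋯ s ] f
      ≡⟨ ∑ˡ-applyUpTo f suc s ⟩
    ∑< s (f ∘ suc)
      ≡⟨ ∑<-cong s (λ m m<s → trans (cong (_* f (suc m)) (⟦⟧-true (all? (m <?_) (x ∷ ρ)) (to m m<s))) (ℚ.*-identityˡ (f (suc m)))) ⟨
    ∑< s (λ m → ⟦ all? (m <?_) (x ∷ ρ) ⟧ * f (suc m))
      ≡⟨ ∑<-extend s≤n (λ m s≤m → trans
           (cong (_* f (suc m)) (⟦⟧-false (all? (m <?_) (x ∷ ρ)) (λ m<π → ℕ.<⇒≱ (Equivalence.from (smallest-> m x ρ) m<π) s≤m)))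
           (ℚ.*-zeroˡ (f (suc m)))) ⟨
    ∑< n (λ m → ⟦ all? (m <?_) (x ∷ ρ) ⟧ * f (suc m)) ∎
    where
    s = smallest (x ∷ ρ)
    to = λ m → Equivalence.to (smallest-> m x ρ)
    s≤n : s ≤ n
    s≤n = ℕ.≤-trans (Extrema.min≤⊤ x ρ) (subst (x ≤_) (IsPartition.total isP) (ℕ.m≤m+n x _))

  distinctSide : (ℕ → ℚ) → ℕ → ℚ
  distinctSide f n = ∑ˡ (𝒟 n) (λ π → sgn (length π ∸ 1) * ∑ˡ [1⋯ smallest π ] f)

  distinctSide-coefficients : ∀ f n .{{_ : NonZero n}} → distinctSide f n ≡ ∑< n (λ m → (- D m n n) * f (suc m))
  distinctSide-coefficients f n@(suc _) = begin
    ∑ˡ (𝒟 n) (λ π → sgn (length π ∸ 1) * ∑ˡ [1⋯ smallest π ] f)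
      ≡⟨ ∑ˡ-filter unique? _ (𝒫 n) ⟩
    psum n (λ π → ⟦ unique? π ⟧ * (sgn (length π ∸ 1) * ∑ˡ [1⋯ smallest π ] f)) n
      ≡⟨ psum-cong n n (λ {π} isP _ → term π isP) ⟩
    psum n (λ π → ∑< n (λ m → (- distinctWeight m π) * f (suc m))) n
      ≡⟨ ∑ˡ-∑< n (λ m π → - distinctWeight m π) (f ∘ suc) (𝒫 n) ⟩
    ∑< n (λ m → ∑ˡ (𝒫 n) (λ π → - distinctWeight m π) * f (suc m))
      ≡⟨ ∑<-cong n (λ m _ → cong (_* f (suc m)) (∑ˡ-neg (distinctWeight m) (𝒫 n))) ⟩
    ∑< n (λ m → (- D m n n) * f (suc m)) ∎
    where
    term : ∀ π → IsPartition n π → ⟦ unique? π ⟧ * (sgn (length π ∸ 1) * ∑ˡ [1⋯ smallest π ] f)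
                                 ≡ ∑< n (λ m → (- distinctWeight m π) * f (suc m))
    term []      isP = contradiction (IsPartition.total isP) (λ ())
    term (x ∷ ρ) isP = begin
      u * (s * ∑ˡ [1⋯ smallest (x ∷ ρ) ] f)
        ≡⟨ cong (λ z → u * (s * z)) (∑-smallest f isP) ⟩
      u * (s * ∑< n (λ m → a m * f (suc m)))
        ≡⟨ ℚ.*-assoc u s _ ⟨
      u * s * ∑< n (λ m → a m * f (suc m))
        ≡⟨ ∑<-*ˡ (u * s) _ n ⟨
      ∑< n (λ m → u * s * (a m * f (suc m)))
        -- The exponent of the sign is one less than the number of parts, whence the minus before
        -- the weight.
        ≡⟨ ∑<-cong n (λ m _ → solve 4 (λ u s a y → u :* s :* (a :* y) := (:- (a :* (u :* (:- s)))) :* y) refl u s (a m) (f (suc m))) ⟩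
      ∑< n (λ m → (- distinctWeight m (x ∷ ρ)) * f (suc m)) ∎
      where
      u = ⟦ unique? (x ∷ ρ) ⟧
      s = sgn (length ρ)
      a = λ m → ⟦ all? (m <?_) (x ∷ ρ) ⟧

  -- The backward difference of order ν π - 1 of f, taken at ℓ π.
  differenceAt : (ℕ → ℚ) → List ℕ → ℚ
  differenceAt f π = ∑ˡ (upTo (ν π)) (λ j → sgn j * (ι ((ν π ∸ 1) C j) * f (ℓ π ∸ j)))

  ℓ-head : ∀ {x ρ} → All (_≤ x) ρ → ℓ (x ∷ ρ) ≡ x
  ℓ-head {x} {ρ} ≤x = ℕ.≤-antisym
    (Extrema.max≤v⁺ {v = x} {⊥ = 0} {xs = x ∷ ρ} z≤n (ℕ.≤-refl ∷ ≤x))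
    (Extrema.v≤max⁺ {v = x} 0 (x ∷ ρ) (inj₂ (here ℕ.≤-refl)))

  -- The binomials vanish from j = ν on, so the range can be made independent of the partition,
  -- whatever f is at the added arguments `x ∸ j`.
  differenceAt-extend : ∀ f {J x ρ} → ν (x ∷ ρ) ≤ J → All (_≤ x) ρ →
    differenceAt f (x ∷ ρ) ≡ ∑< J (λ j → sgn j * ι ((ν (x ∷ ρ) ∸ 1) C j) * f (x ∸ j))
  differenceAt-extend f {J} {x} {ρ} ν≤J ≤x = begin
    differenceAt f (x ∷ ρ)
      ≡⟨ ∑ˡ-applyUpTo _ (λ j → j) v ⟩
    ∑< v (λ j → sgn j * (ι ((v ∸ 1) C j) * f (ℓ (x ∷ ρ) ∸ j)))
      ≡⟨ ∑<-cong v (λ j _ → trans (sym (ℚ.*-assoc (sgn j) _ _)) (cong (λ y → sgn j * ι ((v ∸ 1) C j) * f (y ∸ j)) (ℓ-head ≤x))) ⟩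
    ∑< v (λ j → sgn j * ι ((v ∸ 1) C j) * f (x ∸ j))
      ≡⟨ ∑<-extend ν≤J (λ j v≤j → trans
           (cong (λ c → sgn j * ι c * f (x ∸ j)) (k>n⇒nCk≡0 v≤j))
           (solve 2 (λ s y → s :* con 0ℚ :* y := con 0ℚ) refl (sgn j) (f (x ∸ j)))) ⟨
    ∑< J (λ j → sgn j * ι ((v ∸ 1) C j) * f (x ∸ j)) ∎
    where v = ν (x ∷ ρ)

  -- Sorting by the largest part a + 1 makes q^{a+1} X a j the series that multiplies f (a + 1 - j);
  -- the substitution a = m + j then collects the terms with f (m + 1).
  differenceAt-coefficients : ∀ f n .{{_ : NonZero n}} →
    ∑ˡ (𝒫 n) (differenceAt f) ≡ ∑< n (λ m → R (suc n) m n * f (suc m))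
  differenceAt-coefficients f n@(suc _) = begin
    psum n g n
      ≡⟨ psum-largest n g n ⟩
    ∑< n (λ a → shift (suc a) (psum (suc a) (g ∘ (suc a ∷_))) n)
      ≡⟨ ∑<-cong n (λ a _ → byLargest a) ⟩
    ∑< n (λ a → ∑< J (λ j → h j a))
      ≡⟨ ∑<-swap n J (λ a j → h j a) ⟩
    ∑< J (λ j → ∑< n (h j))
      ≡⟨ ∑<-cong J (λ j _ → ∑<-translate n j (low j) (high j)) ⟩
    ∑< J (λ j → ∑< n (λ m → h j (m ℕ.+ j)))
      ≡⟨ ∑<-swap J n (λ j m → h j (m ℕ.+ j)) ⟩
    ∑< n (λ m → ∑< J (λ j → h j (m ℕ.+ j)))
      ≡⟨ ∑<-cong n (λ m _ → trans
           (∑<-cong J (λ j _ → cong (λ y → shift (suc (m ℕ.+ j)) (X (m ℕ.+ j) j) n * f y) (ℕ.m+n∸n≡m (suc m) j)))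
           (∑<-*ʳ J _ (f (suc m)))) ⟩
    ∑< n (λ m → R J m n * f (suc m)) ∎
    where
    -- Besides the largest part there are at most n others, so n + 1 bounds the number of part
    -- sizes.
    J = suc n
    g = differenceAt f
    h : ℕ → ℕ → ℚ
    h j a = shift (suc a) (X a j) n * f (suc a ∸ j)
    -- For j > a the subtraction truncates to f 0, but `X a` has degree a in x.
    low : ∀ j a → a < j → h j a ≡ 0ℚ
    low j a a<j = trans
      (cong (_* f (suc a ∸ j)) (trans (shift-cong (suc a) (X-above a<j) n) (shift-0 (suc a) n)))
      (ℚ.*-zeroˡ (f (suc a ∸ j)))
    high : ∀ j a → n ≤ a → h j a ≡ 0ℚ
    high j a n≤a = trans (cong (_* f (suc a ∸ j)) (shift-< (X a j) (s≤s n≤a))) (ℚ.*-zeroˡ (f (suc a ∸ j)))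
    w : ℕ → ℕ → List ℕ → ℚ
    w a j ρ = sgn j * ι ((ν (suc a ∷ ρ) ∸ 1) C j)
    byLargest : ∀ a → shift (suc a) (psum (suc a) (g ∘ (suc a ∷_))) n ≡ ∑< J (λ j → h j a)
    byLargest a = begin
      shift (suc a) (psum (suc a) (g ∘ (suc a ∷_))) n
        ≡⟨ shift-cong-≤ (suc a) n (λ k k≤n → trans
             (psum-cong (suc a) k (λ {ρ} isP ≤a → differenceAt-extend f
               (ℕ.≤-trans (List.length-deduplicate ℕ._≟_ (suc a ∷ ρ)) (s≤s (ℕ.≤-trans (length≤total isP) k≤n))) ≤a))
             (trans (∑ˡ-∑< J (w a) (λ j → f (suc a ∸ j)) (boundedPartitions k (suc a) k))
               (∑<-cong J (λ j _ → cong (_* f (suc a ∸ j)) (∑ˡ-*ˡ (sgn j) _ (boundedPartitions k (suc a) k)))))) ⟩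
      shift (suc a) (λ k → ∑< J (λ j → X a j k * f (suc a ∸ j))) n
        ≡⟨ shift-∑< (suc a) J (λ j k → X a j k * f (suc a ∸ j)) n ⟩
      ∑< J (λ j → shift (suc a) (λ k → X a j k * f (suc a ∸ j)) n)
        ≡⟨ ∑<-cong J (λ j _ → shift-*ʳ (suc a) (f (suc a ∸ j)) (X a j) n) ⟩
      ∑< J (λ j → h j a) ∎

  -- Partitions with a single part size

  -- The coefficients of 1/(1 - q^{a+1}), since only copies of a + 1 survive the indicator.
  repeated : ℕ → ℕ → ℚ
  repeated a = psum (suc a) (λ ρ → ⟦ ν (suc a ∷ ρ) ≤? 1 ⟧)

  repeated-rec : ∀ a n → repeated a n ≡ δ n + shift (suc a) (repeated a) n
  repeated-rec a n = begin
    repeated a n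
      ≡⟨ psum-suc a w n ⟩
    psum a w n + shift (suc a) (psum (suc a) (w ∘ (suc a ∷_))) n
      ≡⟨ cong₂ _+_ (new n) (shift-cong (suc a) (λ k → psum-cong (suc a) k (λ {ρ} _ _ →
           cong (λ v → ⟦ v ≤? 1 ⟧) (ν-repeat (suc a) ρ))) n) ⟩
    δ n + shift (suc a) (repeated a) n ∎
    where
    w = λ ρ → ⟦ ν (suc a ∷ ρ) ≤? 1 ⟧
    new : ∀ n → psum a w n ≡ δ n
    new zero    = refl
    new (suc n) = trans (psum-cong a (suc n) (λ {ρ} → two ρ)) (∑ˡ-zero (boundedPartitions (suc n) a (suc n)))
      where
      two : ∀ ρ → IsPartition (suc n) ρ → All (_≤ a) ρ → w ρ ≡ 0ℚ
      two []      isP _  = contradiction (IsPartition.total isP) (λ ())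
      two (x ∷ ρ) _   ≤a = trans (cong (λ v → ⟦ v ≤? 1 ⟧) (ν-new (All.map s≤s ≤a))) refl

  divides-rec : ∀ a n → ⟦ suc a ∣? n ⟧ ≡ δ n + shift (suc a) (λ k → ⟦ suc a ∣? k ⟧) n
  divides-rec a zero    = ⟦⟧-true (suc a ∣? 0) (suc a ∣0)
  divides-rec a (suc n) with ℕ.≤-<-connex a n
  ... | inj₁ a≤n = begin
    ⟦ suc a ∣? suc n ⟧
      ≡⟨ cong (λ k → ⟦ suc a ∣? suc k ⟧) (ℕ.m+[n∸m]≡n a≤n) ⟨
    ⟦ suc a ∣? suc a ℕ.+ (n ∸ a) ⟧
      ≡⟨ ⟦⟧-cong {P? = suc a ∣? suc a ℕ.+ (n ∸ a)} {suc a ∣? (n ∸ a)}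
           (mk⇔ (λ d → ∣m+n∣m⇒∣n d ∣-refl) (∣m∣n⇒∣m+n ∣-refl)) ⟩
    ⟦ suc a ∣? (n ∸ a) ⟧
      ≡⟨ shift-≥ (λ k → ⟦ suc a ∣? k ⟧) a≤n ⟨
    shift a (λ k → ⟦ suc a ∣? k ⟧) n
      ≡⟨ ℚ.+-identityˡ _ ⟨
    0ℚ + shift a (λ k → ⟦ suc a ∣? k ⟧) n ∎
  ... | inj₂ n<a = begin
    ⟦ suc a ∣? suc n ⟧
      ≡⟨ ⟦⟧-false (suc a ∣? suc n) (λ d → ℕ.<⇒≱ (s≤s n<a) (∣⇒≤ d)) ⟩
    0ℚ + 0ℚ
      ≡⟨ cong (0ℚ +_) (shift-< (λ k → ⟦ suc a ∣? k ⟧) n<a) ⟨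
    0ℚ + shift a (λ k → ⟦ suc a ∣? k ⟧) n ∎

  -- Both series solve g = 1 + q^{a+1} g, so their difference is fixed by multiplication by q^{a+1}.
  repeated≗divides : ∀ a → repeated a ≗ λ n → ⟦ suc a ∣? n ⟧
  repeated≗divides a n = begin
    p n                 ≡⟨ solve 2 (λ p i → p := (p :- i) :+ i) refl (p n) (i n) ⟩
    (p n - i n) + i n   ≡⟨ cong (_+ i n) (shift-fixed a (λ n → p n - i n) fixed n) ⟩
    0ℚ + i n            ≡⟨ ℚ.+-identityˡ (i n) ⟩
    i n ∎
    where
    p i : ℕ → ℚ
    p = repeated a
    i n = ⟦ suc a ∣? n ⟧
    fixed : ∀ n → p n - i n ≡ shift (suc a) (λ n → p n - i n) n
    fixed n = begin
      p n - i n
        ≡⟨ cong₂ _-_ (repeated-rec a n) (divides-rec a n) ⟩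
      (δ n + shift (suc a) p n) - (δ n + shift (suc a) i n)
        ≡⟨ solve 3 (λ d p i → (d :+ p) :- (d :+ i) := p :- i) refl (δ n) (shift (suc a) p n) (shift (suc a) i n) ⟩
      shift (suc a) p n - shift (suc a) i n
        ≡⟨ shift-- (suc a) p i n ⟨
      shift (suc a) (λ n → p n - i n) n ∎

  -- A partition of n with one part size repeats a divisor of n, and each divisor arises once.
  single-size : ∀ f n .{{_ : NonZero n}} →
    ∑ˡ (𝒫 n) (λ π → ⟦ ν π ≤? 1 ⟧ * f (ℓ π)) ≡ ∑ˡ (filter (_∣? n) [1⋯ n ]) f
  single-size f n@(suc _) = begin
    psum n w n
      ≡⟨ psum-largest n w n ⟩
    ∑< n (λ a → shift (suc a) (psum (suc a) (w ∘ (suc a ∷_))) n)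
      ≡⟨ ∑<-cong n (λ a _ → byLargest a) ⟩
    ∑< n (λ a → ⟦ suc a ∣? n ⟧ * f (suc a))
      ≡⟨ ∑ˡ-applyUpTo (λ d → ⟦ d ∣? n ⟧ * f d) suc n ⟨
    ∑ˡ [1⋯ n ] (λ d → ⟦ d ∣? n ⟧ * f d)
      ≡⟨ ∑ˡ-filter (_∣? n) f [1⋯ n ] ⟨
    ∑ˡ (filter (_∣? n) [1⋯ n ]) f ∎
    where
    w = λ π → ⟦ ν π ≤? 1 ⟧ * f (ℓ π)
    byLargest : ∀ a → shift (suc a) (psum (suc a) (w ∘ (suc a ∷_))) n ≡ ⟦ suc a ∣? n ⟧ * f (suc a)
    byLargest a = begin
      shift (suc a) (psum (suc a) (w ∘ (suc a ∷_))) n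
        ≡⟨ shift-cong (suc a) (λ k → trans
             (psum-cong (suc a) k (λ {ρ} _ ≤a → trans
               (cong (λ y → ⟦ ν (suc a ∷ ρ) ≤? 1 ⟧ * f y) (ℓ-head ≤a))
               (ℚ.*-comm ⟦ ν (suc a ∷ ρ) ≤? 1 ⟧ (f (suc a)))))
             (trans (∑ˡ-*ˡ (f (suc a)) _ (boundedPartitions k (suc a) k)) (ℚ.*-comm (f (suc a)) (repeated a k)))) n ⟩
      shift (suc a) (λ k → repeated a k * f (suc a)) n
        ≡⟨ shift-*ʳ (suc a) (f (suc a)) (repeated a) n ⟩
      shift (suc a) (repeated a) n * f (suc a)
        -- Since n > 0, the term δ n of the recurrence is 0, and removing the largest part does not
        -- change the count.
        ≡⟨ cong (_* f (suc a)) (trans (sym (ℚ.+-identityˡ (shift (suc a) (repeated a) n))) (trans (sym (repeated-rec a n)) (repeated≗divides a n))) ⟩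
      ⟦ suc a ∣? n ⟧ * f (suc a) ∎

  -- Assembling the rational identity

  -- For ν π = 1 the difference has order zero and equals f (ℓ π); these partitions supply the
  -- divisor sum.
  split-by-ν : ∀ f n .{{_ : NonZero n}} →
    ∑ˡ (filter (λ π → 2 ≤? ν π) (𝒫 n)) (differenceAt f) + ∑ˡ (filter (_∣? n) [1⋯ n ]) f
    ≡ ∑ˡ (𝒫 n) (differenceAt f)
  split-by-ν f n@(suc _) = begin
    ∑ˡ (filter (λ π → 2 ≤? ν π) (𝒫 n)) g + ∑ˡ (filter (_∣? n) [1⋯ n ]) f
      ≡⟨ cong₂ _+_ (∑ˡ-filter (λ π → 2 ≤? ν π) g (𝒫 n)) (sym (single-size f n)) ⟩
    psum n (λ π → ⟦ 2 ≤? ν π ⟧ * g π) n + psum n (λ π → ⟦ ν π ≤? 1 ⟧ * f (ℓ π)) n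
      ≡⟨ ∑ˡ-+ (λ π → ⟦ 2 ≤? ν π ⟧ * g π) (λ π → ⟦ ν π ≤? 1 ⟧ * f (ℓ π)) (𝒫 n) ⟨
    psum n (λ π → ⟦ 2 ≤? ν π ⟧ * g π + ⟦ ν π ≤? 1 ⟧ * f (ℓ π)) n
      ≡⟨ psum-cong n n (λ {π} isP _ → term π isP) ⟩
    psum n g n ∎
    where
    g = differenceAt f
    byCount : ∀ v l → ⟦ 2 ≤? suc v ⟧ * ∑ˡ (upTo (suc v)) (λ j → sgn j * (ι (v C j) * f (l ∸ j))) + ⟦ suc v ≤? 1 ⟧ * f l
                    ≡ ∑ˡ (upTo (suc v)) (λ j → sgn j * (ι (v C j) * f (l ∸ j)))
    byCount zero l = solve 1 (λ y → con 0ℚ :* (con 1ℚ :* (con 1ℚ :* y) :+ con 0ℚ) :+ con 1ℚ :* y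
                                := con 1ℚ :* (con 1ℚ :* y) :+ con 0ℚ) refl (f l)
    byCount (suc v) l = solve 2 (λ s y → con 1ℚ :* s :+ con 0ℚ :* y := s) refl
      (∑ˡ (upTo (suc (suc v))) (λ j → sgn j * (ι (suc v C j) * f (l ∸ j)))) (f l)
    term : ∀ π → IsPartition n π → ⟦ 2 ≤? ν π ⟧ * g π + ⟦ ν π ≤? 1 ⟧ * f (ℓ π) ≡ g π
    term []      isP = contradiction (IsPartition.total isP) (λ ())
    term (x ∷ ρ) isP = byCount (ν (x ∷ ρ) ∸ 1) (ℓ (x ∷ ρ))

  rational-identity : ∀ f n .{{_ : NonZero n}} →
    distinctSide f n ≡ ∑ˡ (filter (λ π → 2 ≤? ν π) (𝒫 n)) (differenceAt f) + ∑ˡ (filter (_∣? n) [1⋯ n ]) f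
  rational-identity f n@(suc _) = begin
    distinctSide f n
      ≡⟨ distinctSide-coefficients f n ⟩
    ∑< n (λ m → (- D m n n) * f (suc m))
      -- For n > 0 the coefficient of qⁿ in the series 1 is 0, so `- D m n n` equals
      -- `δ n - D m n n`.
      ≡⟨ ∑<-cong n (λ m m<n → cong (_* f (suc m)) (trans (sym (ℚ.+-identityˡ (- D m n n)))
           (coefficients-agree (ℕ.n≤1+n n) (n ∸ m) m (ℕ.m+[n∸m]≡n (ℕ.<⇒≤ m<n)) n ℕ.≤-refl))) ⟩
    ∑< n (λ m → R (suc n) m n * f (suc m))
      ≡⟨ differenceAt-coefficients f n ⟨
    ∑ˡ (𝒫 n) (differenceAt f)
      ≡⟨ split-by-ν f n ⟨
    ∑ˡ (filter (λ π → 2 ≤? ν π) (𝒫 n)) (differenceAt f) + ∑ˡ (filter (_∣? n) [1⋯ n ]) f ∎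

open RationalIdentity using (sgn; ∑ˡ; distinctSide; differenceAt; rational-identity)

-- Passage to the complex numbers

infixl 6 _⊕_
infixl 7 _⊗_
_⊕_ _⊗_ : ℚ × ℚ → ℚ × ℚ → ℚ × ℚ
(a , b) ⊕ (c , d) = a ℚ.+ c , b ℚ.+ d
(a , b) ⊗ (c , d) = a ℚ.* c ℚ.- b ℚ.* d , a ℚ.* d ℚ.+ b ℚ.* c

data Operations {Carrier : Set} (_+_ _*_ : Carrier → Carrier → Carrier) (-1# : Carrier)
  (_^_ : Carrier → ℕ → Carrier) (_·_ : ℕ → Carrier → Carrier)
  (∑ : {A : Set} → List A → (A → Carrier) → Carrier) (F : ℕ → Carrier) : Set where
  operations : Operations _+_ _*_ -1# _^_ _·_ ∑ F

-- The operations of ℂ act entrywise on the approximating sequences, so it suffices to compare all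
-- approximations ψ, which take values in ℚ(i).  The carrier is abstract because a comparison of
-- concrete complex numbers would unfold their Cauchy proofs; for the same reason the operations
-- are passed as the index of Operations: Agda then compares the terms of the theorem syntactically.
module Evaluation {Carrier : Set} {_+_ _*_ : Carrier → Carrier → Carrier} { -1# : Carrier}
  {_^_ : Carrier → ℕ → Carrier} {_·_ : ℕ → Carrier → Carrier}
  {∑ : {A : Set} → List A → (A → Carrier) → Carrier} {F : ℕ → Carrier}
  (_ : Operations _+_ _*_ -1# _^_ _·_ ∑ F)
  (ψ : Carrier → ℚ × ℚ)
  (ψ-[]    : ∀ {A : Set} (f : A → Carrier) → ψ (∑ [] f) ≡ (0ℚ , 0ℚ))
  (ψ-∷     : ∀ {A : Set} (f : A → Carrier) x xs → ψ (∑ (x ∷ xs) f) ≡ ψ (f x) ⊕ ψ (∑ xs f))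
  (ψ-0·    : ∀ z → ψ (0 · z) ≡ (0ℚ , 0ℚ))
  (ψ-suc·  : ∀ n z → ψ (suc n · z) ≡ ψ z ⊕ ψ (n · z))
  (ψ-^0    : ∀ z → ψ (z ^ 0) ≡ (1ℚ , 0ℚ))
  (ψ-^-suc : ∀ z n → ψ (z ^ suc n) ≡ ψ z ⊗ ψ (z ^ n))
  (ψ-−1    : ψ -1# ≡ (ℚ.- 1ℚ , 0ℚ))
  (ψ-*     : ∀ z w → ψ (z * w) ≡ ψ z ⊗ ψ w)
  where

  real-⊗ : ∀ r z → (r , 0ℚ) ⊗ z ≡ (r ℚ.* proj₁ z , r ℚ.* proj₂ z)
  real-⊗ r (a , b) = cong₂ _,_
    (solve 3 (λ r a b → r :* a :- con 0ℚ :* b := r :* a) refl r a b)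
    (solve 3 (λ r a b → r :* b :+ con 0ℚ :* a := r :* b) refl r a b)

  ψ-sign : ∀ j → ψ (-1# ^ j) ≡ (sgn j , 0ℚ)
  ψ-sign zero    = ψ-^0 -1#
  ψ-sign (suc j) = begin
    ψ (-1# ^ suc j)                ≡⟨ ψ-^-suc -1# j ⟩
    ψ -1# ⊗ ψ (-1# ^ j)            ≡⟨ cong₂ _⊗_ ψ-−1 (ψ-sign j) ⟩
    (ℚ.- 1ℚ , 0ℚ) ⊗ (sgn j , 0ℚ)   ≡⟨ real-⊗ (ℚ.- 1ℚ) (sgn j , 0ℚ) ⟩
    ((ℚ.- 1ℚ) ℚ.* sgn j , 0ℚ)      ≡⟨ cong (_, 0ℚ) (solve 1 (λ s → (:- con 1ℚ) :* s := :- s) refl (sgn j)) ⟩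
    (sgn (suc j) , 0ℚ) ∎

  ψ-sign-* : ∀ j z → ψ ((-1# ^ j) * z) ≡ (sgn j ℚ.* proj₁ (ψ z) , sgn j ℚ.* proj₂ (ψ z))
  ψ-sign-* j z = begin
    ψ ((-1# ^ j) * z)      ≡⟨ ψ-* (-1# ^ j) z ⟩
    ψ (-1# ^ j) ⊗ ψ z      ≡⟨ cong (_⊗ ψ z) (ψ-sign j) ⟩
    (sgn j , 0ℚ) ⊗ ψ z     ≡⟨ real-⊗ (sgn j) (ψ z) ⟩
    (sgn j ℚ.* proj₁ (ψ z) , sgn j ℚ.* proj₂ (ψ z)) ∎

  -- Multiplication in ℚ(i) mixes the coordinates, but outside F the theorem multiplies only by
  -- signs and natural numbers, which act on each coordinate separately. One proof therefore serves
  -- real and imaginary parts.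
  module Component (φ : Carrier → ℚ)
    (φ-[]   : ∀ {A : Set} (f : A → Carrier) → φ (∑ [] f) ≡ 0ℚ)
    (φ-∷    : ∀ {A : Set} (f : A → Carrier) x xs → φ (∑ (x ∷ xs) f) ≡ φ (f x) ℚ.+ φ (∑ xs f))
    (φ-0·   : ∀ z → φ (0 · z) ≡ 0ℚ)
    (φ-suc· : ∀ n z → φ (suc n · z) ≡ φ z ℚ.+ φ (n · z))
    (φ-sign : ∀ j z → φ ((-1# ^ j) * z) ≡ sgn j ℚ.* φ z)
    where

    φ-· : ∀ n z → φ (n · z) ≡ ι n ℚ.* φ z
    φ-· zero    z = trans (φ-0· z) (sym (ℚ.*-zeroˡ (φ z)))
    φ-· (suc n) z = begin
      φ (suc n · z)                 ≡⟨ trans (φ-suc· n z) (cong (φ z ℚ.+_) (φ-· n z)) ⟩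
      φ z ℚ.+ ι n ℚ.* φ z           ≡⟨ solve 2 (λ n z → z :+ n :* z := (con 1ℚ :+ n) :* z) refl (ι n) (φ z) ⟩
      (1ℚ ℚ.+ ι n) ℚ.* φ z          ≡⟨ cong (ℚ._* φ z) (ι-+ 1 n) ⟨
      ι (suc n) ℚ.* φ z ∎

    φ-∑ : ∀ {A : Set} (xs : List A) (f : A → Carrier) (g : A → ℚ) → (∀ x → φ (f x) ≡ g x) → φ (∑ xs f) ≡ ∑ˡ xs g
    φ-∑ []       f g eq = φ-[] f
    φ-∑ (x ∷ xs) f g eq = trans (φ-∷ f x xs) (cong₂ ℚ._+_ (eq x) (φ-∑ xs f g eq))

    -- The divisor sum enters as a rational `s` tied to it by an equation, because `σ` is not among
    -- the abstract operations.
    evaluated-identity : ∀ n .{{_ : NonZero n}} {s} → ∑ˡ (filter (_∣? n) [1⋯ n ]) (λ d → φ (F d)) ≡ s →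
      φ (∑ (𝒟 n) λ π → (-1# ^ (length π ∸ 1)) * ∑ [1⋯ smallest π ] λ j → F j)
      ≡ φ (∑ (filter (λ π → 2 ≤? ν π) (𝒫 n)) λ π →
             ∑ (upTo (ν π)) λ j → (-1# ^ j) * (((ν π ∸ 1) C j) · F (ℓ π ∸ j)))
        ℚ.+ s
    evaluated-identity n refl = begin
      φ (∑ (𝒟 n) _)
        ≡⟨ φ-∑ (𝒟 n) _ _ (λ π → trans (φ-sign (length π ∸ 1) _)
             (cong (sgn (length π ∸ 1) ℚ.*_) (φ-∑ [1⋯ smallest π ] F f (λ _ → refl)))) ⟩
      distinctSide f n
        ≡⟨ rational-identity f n ⟩
      ∑ˡ (filter (λ π → 2 ≤? ν π) (𝒫 n)) (differenceAt f) ℚ.+ ∑ˡ (filter (_∣? n) [1⋯ n ]) f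
        ≡⟨ cong (ℚ._+ ∑ˡ (filter (_∣? n) [1⋯ n ]) f)
             (φ-∑ (filter (λ π → 2 ≤? ν π) (𝒫 n)) _ (differenceAt f) (λ π → φ-∑ (upTo (ν π)) _ _ (λ j →
               trans (φ-sign j _) (cong (sgn j ℚ.*_) (φ-· ((ν π ∸ 1) C j) (F (ℓ π ∸ j))))))) ⟨
      φ (∑ (filter (λ π → 2 ≤? ν π) (𝒫 n)) _) ℚ.+ ∑ˡ (filter (_∣? n) [1⋯ n ]) f ∎
      where
      f : ℕ → ℚ
      f j = φ (F j)

  open Component (proj₁ ∘ ψ) (cong proj₁ ∘ ψ-[]) (λ f x xs → cong proj₁ (ψ-∷ f x xs))
    (cong proj₁ ∘ ψ-0·) (λ n z → cong proj₁ (ψ-suc· n z))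
    (λ j z → cong proj₁ (ψ-sign-* j z))
    public using () renaming (evaluated-identity to re-identity)
  open Component (proj₂ ∘ ψ) (cong proj₂ ∘ ψ-[]) (λ f x xs → cong proj₂ (ψ-∷ f x xs))
    (cong proj₂ ∘ ψ-0·) (λ n z → cong proj₂ (ψ-suc· n z))
    (λ j z → cong proj₂ (ψ-sign-* j z))
    public using () renaming (evaluated-identity to im-identity)

open import Defs

ℂ-operations : ∀ k c → Operations _+_ _*_ (- 1#) _^_ _·_ ∑ (λ j → j ^ᶜ k * c ^ j)
ℂ-operations k c = operations

approximation : ℕ → ℂ → ℚ × ℚ
approximation i z = seq (re z) i , seq (im z) i

close : ∀ {x y : ℕ → ℚ} → (∀ i → x i ≡ y i) → ∀ ε → 0ℚ ℚ.< ε → ∃[ N ] ∀ i → N ≤ i → ℚ.∣ x i ℚ.- y i ∣ ℚ.< ε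
close {x} {y} eq ε 0<ε = 0 , λ i _ → subst (ℚ._< ε)
  (sym (cong ℚ.∣_∣ (trans (cong (ℚ._- y i) (eq i)) (ℚ.+-inverseʳ (y i))))) 0<ε

additive-foldr : ∀ {A B : Set} (φ : B → ℚ) (_⊕_ : B → B → B) (e : B) →
  φ e ≡ 0ℚ → (∀ a b → φ (a ⊕ b) ≡ φ a ℚ.+ φ b) →
  ∀ (xs : List A) (f : A → B) (g : A → ℚ) → (∀ x → φ (f x) ≡ g x) → φ (foldr (λ x s → f x ⊕ s) e xs) ≡ ∑ˡ xs g
additive-foldr φ _⊕_ e φ-e φ-⊕ []       f g eq = φ-e
additive-foldr φ _⊕_ e φ-e φ-⊕ (x ∷ xs) f g eq = trans (φ-⊕ (f x) (foldr (λ x s → f x ⊕ s) e xs))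
  (cong₂ ℚ._+_ (eq x) (additive-foldr φ _⊕_ e φ-e φ-⊕ xs f g eq))

σ-re : ∀ k c n i → ∑ˡ (filter (_∣? n) [1⋯ n ]) (λ d → seq (re (d ^ᶜ k * c ^ d)) i) ≡ seq (re (σ k c n)) i
σ-re k c n i = sym (additive-foldr (λ z → seq (re z) i) _+_ 0# refl (λ _ _ → refl)
  (filter (_∣? n) [1⋯ n ]) (λ d → d ^ᶜ k * c ^ d) (λ d → seq (re (d ^ᶜ k * c ^ d)) i) (λ _ → refl))

σ-im : ∀ k c n i → ∑ˡ (filter (_∣? n) [1⋯ n ]) (λ d → seq (im (d ^ᶜ k * c ^ d)) i) ≡ seq (im (σ k c n)) i
σ-im k c n i = sym (additive-foldr (λ z → seq (im z) i) _+_ 0# refl (λ _ _ → refl)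
  (filter (_∣? n) [1⋯ n ]) (λ d → d ^ᶜ k * c ^ d) (λ d → seq (im (d ^ᶜ k * c ^ d)) i) (λ _ → refl))

theorem2p6 : (n : ℕ) .{{_ : NonZero n}} (k c : ℂ) →
    (∑[ π ∈ 𝒟 n ] ((- 1#) ^ (length π ∸ 1) * (∑[ j ∈ [1⋯ smallest π ] ] (j ^ᶜ k * c ^ j))))
    ≈
    (∑[ π ∈ filter (λ π → 2 ≤? ν π) (𝒫 n) ]
    (∑[ j ∈ upTo (ν π) ]
    ((- 1#) ^ j * (((ν π ∸ 1) C j) · ((ℓ π ∸ j) ^ᶜ k * c ^ (ℓ π ∸ j))))))
    + σ k c n
theorem2p6 n k c =
    -- The two sides agree at every index of the approximating sequences; the evaluation laws hold
    -- by computation because each operation of ℂ is pointwise.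
    close (λ i → Evaluation.re-identity (ℂ-operations k c) (approximation i)
      (λ _ → refl) (λ _ _ _ → refl) (λ _ → refl) (λ _ _ → refl) (λ _ → refl) (λ _ _ → refl)
      refl (λ _ _ → refl) n (σ-re k c n i))
  , close (λ i → Evaluation.im-identity (ℂ-operations k c) (approximation i)
      (λ _ → refl) (λ _ _ _ → refl) (λ _ → refl) (λ _ _ → refl) (λ _ → refl) (λ _ _ → refl)
      refl (λ _ _ → refl) n (σ-im k c n i))
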